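{- Let $G=(V,E)$ be a finite simple graph with $V\neq\emptyset$, $E\neq\emptyset$, and a linear ordering of $E$, and let $e_{\max}$ be the maximal edge of $G$. Let $c_0(G)=0$ and, for $i=1,2,3,\dots$, $$c_i(G)=\sum_{\substack{V=V_1\sqcup\cdots\sqcup V_{i+1}\\ e_{\max}\notin G[V_j],\ j=1,\dots,i+1}}\ \prod_{j=1}^{i+1}h_1(G[V_j]),$$ where the sum is over all (unordered) decompositions of $V$ into $i+1$ non-empty disjoint subsets $V_1,\dots,V_{i+1}$ such that $e_{\max}$ is not an edge of any $G[V_j]$. Then for all $i\geq 1$, $$h_i(G)=c_{i-1}(G)+c_i(G).$$
   Context: For a finite simple graph $G=(V,E)$ with a linear ordering of $E$, a broken cycle of $G$ is a set of edges obtained by removing the maximal edge from (the edge set of) a cycle of $G$. With $n=|V|$, $h_i(G)$ denotes the number of spanning subgraphs of $G$ with $n-i$ edges containing no broken cycle, i.e. the number of $F\subseteq E$ with $|F|=n-i$ such that no broken cycle of $G$ is a subset of $F$ (so $h_i(G)=0$ for $i>n$). For non-empty $V'\subseteq V$, $G[V']$ is the subgraph of $G$ induced by $V'$, with its edges ordered by the restriction of the ordering of $E$. An empty sum is $0$. -}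

module Defs where

open import Data.Nat.Base as ℕ using (ℕ; zero; suc; _+_)
import Data.Nat.Properties as ℕ
open import Data.Nat.DivMod using (_mod_)
open import Data.Nat.ListAction using (sum; product)
open import Data.Fin.Base using (Fin; zero; suc; toℕ; _≤_)
open import Data.Fin.Properties using (_≟_; _≤?_; any?; all?; injective⇒≤)
open import Data.Fin.Subset
  using (Subset; inside; outside; _∈_; _∉_; _⊆_; _⊈_; ⁅_⁆; _∩_; _∪_; _-_; ⋃; ∣_∣;
         Nonempty; Empty)
open import Data.Fin.Subset.Properties
  using (_∈?_; _⊆?_; nonempty?; anySubset?)
open import Data.Vec.Base using (Vec; []; _∷_; lookup; tabulate)
open import Data.Vec.Properties using ([]=⇒lookup; lookup⇒[]=; lookup∘tabulate; ≡-dec)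
open import Data.Vec.Relation.Unary.Unique.Propositional using (Unique)
open import Data.Vec.Relation.Unary.Unique.Propositional.Properties using (lookup-injective)
import Data.Vec.Relation.Unary.AllPairs as VecAllPairs
open import Data.List.Base using (List; []; _∷_; _++_; map; filter; length)
open import Data.List.Relation.Unary.All as All using (All)
open import Data.List.Relation.Unary.AllPairs as AllPairs using (AllPairs)
open import Data.Product.Base using (∃; ∃-syntax; _×_; _,_; proj₁; proj₂)
import Data.Bool.Properties as Bool
open import Relation.Nullary using (Dec; yes; no; does; ¬_; ¬?)
open import Relation.Nullary.Decidable using (map′; _×-dec_; _→-dec_; dec-true; dec-false)
open import Relation.Nullary.Negation using (contradiction)
open import Relation.Unary using (Pred; Decidable)
open import Relation.Binary.Definitions using (DecidableEquality)
open import Relation.Binary.PropositionalEquality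
  using (_≡_; refl; sym; trans; cong)
open import Level using (0ℓ)

private
  variable
    N M : ℕ

subset-≟ : DecidableEquality (Subset N)
subset-≟ = ≡-dec Bool._≟_

comprehension : {P : Pred (Fin N) 0ℓ} → Decidable P → Subset N
comprehension P? = tabulate (λ x → does (P? x))

∈-comprehension⁺ : {P : Pred (Fin N) 0ℓ} (P? : Decidable P) →
                   ∀ {x} → P x → x ∈ comprehension P?
∈-comprehension⁺ P? {x} px =
  lookup⇒[]= x _ (trans (lookup∘tabulate _ x) (dec-true (P? x) px))

∈-comprehension⁻ : {P : Pred (Fin N) 0ℓ} (P? : Decidable P) →
                   ∀ {x} → x ∈ comprehension P? → P x
∈-comprehension⁻ P? {x} x∈ with P? x in eq
... | yes px = px
... | no ¬px = contradiction
  (trans (sym ([]=⇒lookup x∈)) (trans (lookup∘tabulate _ x) (cong does eq))) λ ()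

allSubsets : ∀ N → List (Subset N)
allSubsets zero    = [] ∷ []
allSubsets (suc N) = map (outside ∷_) (allSubsets N) ++ map (inside ∷_) (allSubsets N)

sublists : {A : Set} → List A → List (List A)
sublists []       = [] ∷ []
sublists (x ∷ xs) = sublists xs ++ map (x ∷_) (sublists xs)

-- Vertices carry labels in Fin N and edges carry labels in Fin M, so that
-- an induced subgraph keeps the labels of the ambient graph.  An edge is
-- identified with the 2-element set of its ends.  The linear ordering of
-- the edge set is the order of Fin M restricted to it.
record OrderedGraph (N M : ℕ) : Set where
  field
    V            : Subset N
    E            : Subset M
    ends         : Fin M → Subset N
    ∣ends∣≡2     : ∀ e → ∣ ends e ∣ ≡ 2
    ends-injective : ∀ {e f} → ends e ≡ ends f → e ≡ f
    ends⊆V       : ∀ {e} → e ∈ E → ends e ⊆ V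

open OrderedGraph public

-- The induced subgraph, for W ⊆ V G.
infix 8 _[_]

_[_] : OrderedGraph N M → Subset N → OrderedGraph N M
G [ W ] = record
  { V              = W
  ; E              = comprehension induced?
  ; ends           = ends G
  ; ∣ends∣≡2       = ∣ends∣≡2 G
  ; ends-injective = ends-injective G
  ; ends⊆V         = λ e∈ → proj₂ (∈-comprehension⁻ induced? e∈)
  }
  where
  induced? : Decidable (λ e → e ∈ E G × ends G e ⊆ W)
  induced? e = (e ∈? E G) ×-dec (ends G e ⊆? W)

_IsMaximumOf_ : Fin M → Subset M → Set
e IsMaximumOf S = e ∈ S × (∀ f → f ∈ S → f ≤ e)

Joins : OrderedGraph N M → Fin M → Fin N → Fin N → Set
Joins G e u v = e ∈ E G × ends G e ≡ ⁅ u ⁆ ∪ ⁅ v ⁆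

-- Cyclic successor: i ↦ i + 1 modulo k + 1.
next : ∀ {k} → Fin (suc k) → Fin (suc k)
next {k} i = suc (toℕ i) mod suc k

-- C is the edge set of the cycle v₀ v₁ ⋯ vₖ₊₂ v₀ of G.
IsCycleThrough : (G : OrderedGraph N M) (C : Subset M) {k : ℕ} → Vec (Fin N) (3 + k) → Set
IsCycleThrough G C v =
  Unique v
  × (∀ i → ∃[ e ] (e ∈ C × Joins G e (lookup v i) (lookup v (next i))))
  × (∀ e → e ∈ C → ∃[ i ] Joins G e (lookup v i) (lookup v (next i)))

IsCycle : OrderedGraph N M → Subset M → Set
IsCycle {N} G C = ∃[ k ] ∃[ v ] IsCycleThrough G C {k} v

IsBrokenCycle : OrderedGraph N M → Subset M → Set
IsBrokenCycle G B = ∃[ C ] (IsCycle G C × ∃[ e ] (e IsMaximumOf C × B ≡ C - e))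

ContainsNoBrokenCycle : OrderedGraph N M → Subset M → Set
ContainsNoBrokenCycle G F = ∀ B → IsBrokenCycle G B → B ⊈ F

anyVec? : ∀ k {P : Pred (Vec (Fin N) k) 0ℓ} → Decidable P → Dec (∃ P)
anyVec? zero    P? = map′ (λ p → [] , p) (λ { ([] , p) → p }) (P? [])
anyVec? (suc k) P? =
  map′ (λ { (x , xs , p) → x ∷ xs , p }) (λ { (x ∷ xs , p) → x , xs , p })
       (any? λ x → anyVec? k λ xs → P? (x ∷ xs))

joins? : (G : OrderedGraph N M) → ∀ e u v → Dec (Joins G e u v)
joins? G e u v = (e ∈? E G) ×-dec subset-≟ (ends G e) (⁅ u ⁆ ∪ ⁅ v ⁆)

isCycleThrough? : (G : OrderedGraph N M) (C : Subset M) {k : ℕ} →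
                  Decidable (IsCycleThrough G C {k})
isCycleThrough? G C v =
  VecAllPairs.allPairs? (λ x y → ¬? (x ≟ y)) v
  ×-dec all? (λ i → any? λ e → (e ∈? C) ×-dec joins? G e _ _)
  ×-dec all? (λ e → (e ∈? C) →-dec any? λ i → joins? G e _ _)

isCycle? : (G : OrderedGraph N M) → Decidable (IsCycle G)
isCycle? {N} G C =
  map′ (λ { (k , _ , c) → k , c }) (λ { (k , v , c) → k , bound v c , v , c })
       (ℕ.anyUpTo? (λ k → anyVec? (3 + k) (isCycleThrough? G C {k})) N)
  where
  bound : ∀ {k} (v : Vec (Fin N) (3 + k)) → IsCycleThrough G C v → k ℕ.< N
  bound v (distinct , _) =
    ℕ.≤-trans (ℕ.m≤n+m _ 2) (injective⇒≤ (λ {i} {j} → lookup-injective distinct i j))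

_isMaximumOf?_ : (e : Fin M) (S : Subset M) → Dec (e IsMaximumOf S)
e isMaximumOf? S = (e ∈? S) ×-dec all? (λ f → (f ∈? S) →-dec (f ≤? e))

isBrokenCycle? : (G : OrderedGraph N M) → Decidable (IsBrokenCycle G)
isBrokenCycle? G B = anySubset? λ C →
  isCycle? G C ×-dec any? λ e → (e isMaximumOf? C) ×-dec subset-≟ B (C - e)

containsNoBrokenCycle? : (G : OrderedGraph N M) → Decidable (ContainsNoBrokenCycle G)
containsNoBrokenCycle? G F = map′ to from (¬? broken?)
  where
  Broken : Set
  Broken = ∃[ B ] (IsBrokenCycle G B × B ⊆ F)

  broken? : Dec Broken
  broken? = anySubset? λ B → isBrokenCycle? G B ×-dec (B ⊆? F)

  to : ¬ Broken → ContainsNoBrokenCycle G F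
  to none B b B⊆F = none (B , b , B⊆F)

  from : ContainsNoBrokenCycle G F → ¬ Broken
  from nbc (B , b , B⊆F) = nbc B b B⊆F

-- ∣ F ∣ = n - i is written additively, so that there is no such F when i > n.
CountedBy-h : ℕ → OrderedGraph N M → Subset M → Set
CountedBy-h i G F = F ⊆ E G × ∣ F ∣ + i ≡ ∣ V G ∣ × ContainsNoBrokenCycle G F

countedBy-h? : ∀ i (G : OrderedGraph N M) → Decidable (CountedBy-h i G)
countedBy-h? i G F =
  (F ⊆? E G) ×-dec (∣ F ∣ + i ℕ.≟ ∣ V G ∣) ×-dec containsNoBrokenCycle? G F

h : ℕ → OrderedGraph N M → ℕ
h {M = M} i G = length (filter (countedBy-h? i G) (allSubsets M))

-- Vs lists the blocks of a decomposition of V G into k blocks, none of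
-- which induces a subgraph containing the edge e.
IsDecomposition : OrderedGraph N M → Fin M → ℕ → List (Subset N) → Set
IsDecomposition G e k Vs =
  length Vs ≡ k
  × All Nonempty Vs
  × AllPairs (λ A B → Empty (A ∩ B)) Vs
  × ⋃ Vs ≡ V G
  × All (λ W → e ∉ E (G [ W ])) Vs

isDecomposition? : (G : OrderedGraph N M) (e : Fin M) (k : ℕ) → Decidable (IsDecomposition G e k)
isDecomposition? G e k Vs =
  (length Vs ℕ.≟ k)
  ×-dec All.all? nonempty? Vs
  ×-dec AllPairs.allPairs? (λ A B → ¬? (nonempty? (A ∩ B))) Vs
  ×-dec subset-≟ (⋃ Vs) (V G)
  ×-dec All.all? (λ W → ¬? (e ∈? E (G [ W ]))) Vs

-- Unordered decompositions are sets of blocks: each set of subsets of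
-- Fin N occurs exactly once as a sublist of the repetition-free list
-- allSubsets N.
decompositions : OrderedGraph N M → Fin M → ℕ → List (List (Subset N))
decompositions {N} G e k = filter (isDecomposition? G e k) (sublists (allSubsets N))

-- The argument e stands for the maximal edge of G.
c : ℕ → OrderedGraph N M → Fin M → ℕ
c zero    G e = 0
c (suc i) G e =
  sum (map (λ Vs → product (map (λ W → h 1 (G [ W ])) Vs)) (decompositions G e (suc (suc i))))

{-# OPTIONS --safe #-}
module Submission where

-- Call an edge set NBC if it contains no broken cycle.  A broken cycle never
-- contains the maximal edge e of G, so adding or removing e preserves NBC;
-- hence h_i(G) = a_i + a_(i+1), where a_k counts the NBC sets avoiding e with
-- ∣V∣ - k edges.  An NBC set is a forest, so a set counted by a_k consists of
-- spanning trees of its k components.  It is NBC iff each of the trees is,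
-- and no component contains both ends of e, since otherwise e would close a
-- cycle in which it is maximal.  Grouping by components gives a_k = c_(k-1)(G).

open import Defs
open import Data.Nat using (ℕ; _+_; _∸_; _≤_)
open import Data.Fin using (Fin)
open import Data.Fin.Subset using (Nonempty)
open import Relation.Binary.PropositionalEquality using (_≡_)

open import Data.Nat.Base as ℕ using (zero; suc; _*_)
import Data.Nat.Properties as ℕ
open import Data.Nat.DivMod using (m<n⇒m%n≡m; n%n≡0)
open import Data.Nat.Induction using (<-wellFounded)
open import Data.Nat.ListAction using (sum; product)
open import Algebra.Properties.CommutativeSemigroup ℕ.+-commutativeSemigroup
  using (interchange; x∙yz≈y∙xz)
open import Induction.WellFounded using (Acc; acc)
open import Data.Fin.Base using (zero; suc; toℕ; inject₁; fromℕ)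
import Data.Fin.Base as Fin
import Data.Fin.Properties as Fin
open import Data.Fin.Properties using (_≟_; any?)
open import Data.Fin.Induction using (<-weakInduction; >-weakInduction)
open import Data.Fin.Relation.Unary.Top using (view; ‵fromℕ; ‵inject₁)
open import Data.Fin.Subset
  using (Subset; inside; outside; _∈_; _∉_; _⊆_; ⊥; ⁅_⁆; _∩_; _∪_; _-_; ⋃; ∣_∣; Empty)
open import Data.Fin.Subset.Properties
open import Data.Vec.Base using (Vec; []; _∷_; lookup; here; there)
open import Data.Vec.Properties using (∷-injectiveʳ)
open import Data.Vec.Relation.Unary.Unique.Propositional using () renaming (Unique to UniqueVec)
open import Data.Vec.Relation.Unary.Unique.Propositional.Properties using (lookup-injective)
import Data.Vec.Relation.Unary.All as VecAll
import Data.Vec.Relation.Unary.Any as VecAny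
import Data.Vec.Relation.Unary.AllPairs as VecAllPairs
open import Data.List.Base using (List; []; _∷_; _++_; map; filter; length; cartesianProduct)
open import Data.List.Properties
  using (filter-accept; filter-reject; filter-none; length-++; length-map;
         map-id-local; map-cong-local; map-∘)
open import Data.List.Membership.Propositional using () renaming (_∈_ to _∈ˡ_)
open import Data.List.Membership.Propositional.Properties
  using (∈-map⁺; ∈-map⁻; ∈-++⁺ˡ; ∈-++⁺ʳ; ∈-++⁻; ∈-filter⁺; ∈-filter⁻;
         ∈-cartesianProduct⁺; ∈-cartesianProduct⁻)
open import Data.List.Membership.Propositional.Properties.WithK using (unique∧set⇒bag)
open import Data.List.Relation.Binary.BagAndSetEquality using (∼bag⇒↭)
open import Data.List.Relation.Binary.Permutation.Propositional.Properties using (↭-length)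
open import Data.List.Relation.Unary.All as All using (All; []; _∷_)
open import Data.List.Relation.Unary.Any using (here; there)
open import Data.List.Relation.Unary.AllPairs using (AllPairs; []; _∷_)
open import Data.List.Relation.Unary.Unique.Propositional using (Unique)
import Data.List.Relation.Unary.Unique.Propositional.Properties as Unique
open import Data.Product.Base using (∃₂; ∃-syntax; _×_; _,_; proj₁; proj₂)
open import Data.Sum.Base using (_⊎_; inj₁; inj₂)
open import Data.Bool.Base using (if_then_else_)
open import Function.Base using (_∘_; id)
open import Function.Bundles using (mk⇔)
open import Level using (0ℓ)
open import Relation.Nullary using (Dec; yes; no; does; ¬_; ¬?; contradiction)
open import Relation.Nullary.Decidable using (_×-dec_; dec-true; dec-false)
open import Relation.Unary using (Pred; Decidable)
open import Relation.Binary.Core using (Rel)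
open import Relation.Binary.Definitions using (Symmetric)
open import Relation.Binary.Construct.Closure.ReflexiveTransitive as Star using (Star; ε; _◅_; _◅◅_)
open import Relation.Binary.PropositionalEquality
  using (_≢_; refl; sym; trans; cong; cong₂; subst; module ≡-Reasoning)

-- Broken cycles, given through vectors of vertices, are awkward to cut along blocks or to glue.
-- Such arguments therefore use an equivalent condition on paths: no edge of `G` has its ends joined
-- by strictly smaller edges of `F`. These paths restrict to a block, cannot leave a block when `F`
-- lies within the blocks, and never use the maximal edge. The forest property is not expressed by
-- acyclicity either. What the counting needs is the identity edges + components = vertices, and a
-- `Rooting` carries it for every union of components. The grouping is a double count of the pairs
-- related by `Splits`: a set counted by a_k is related to exactly one decomposition into k blocks,
-- and a decomposition is related to as many sets as the product of its h_1 values. For k = 1 there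
-- is no admissible decomposition, since a single block contains both ends of e; this is where c_0 =
-- 0 comes from.

private
  variable
    N M : ℕ
    A B : Set

-- Counting with duplicate-free lists

length-set : {xs ys : List A} → Unique xs → Unique ys →
             (∀ {x} → x ∈ˡ xs → x ∈ˡ ys) → (∀ {x} → x ∈ˡ ys → x ∈ˡ xs) →
             length xs ≡ length ys
length-set uxs uys to from =
  ↭-length (∼bag⇒↭ (unique∧set⇒bag uxs uys (mk⇔ to from)))

length-bijection : {xs : List A} {ys : List B} (f : A → B) (g : B → A) →
                   Unique xs → Unique ys →
                   (∀ {x} → x ∈ˡ xs → f x ∈ˡ ys) → (∀ {y} → y ∈ˡ ys → g y ∈ˡ xs) →
                   (∀ {x} → x ∈ˡ xs → g (f x) ≡ x) → (∀ {y} → y ∈ˡ ys → f (g y) ≡ y) →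
                   length xs ≡ length ys
length-bijection {xs = xs} {ys} f g uxs uys f∈ g∈ gf fg =
  trans (sym (length-map f xs)) (length-set ufxs uys to from)
  where
  gfxs≡xs : map g (map f xs) ≡ xs
  gfxs≡xs = trans (sym (map-∘ xs)) (map-id-local (All.tabulate gf))

  -- `f` is known to be injective only on the members of `xs`. A repetition in `map f xs` would
  -- survive under `g`, and `map g (map f xs)` is `xs`.
  ufxs : Unique (map f xs)
  ufxs = Unique.map⁻ {f = g} (subst Unique (sym gfxs≡xs) uxs)

  to : ∀ {y} → y ∈ˡ map f xs → y ∈ˡ ys
  to y∈ with x , x∈ , refl ← ∈-map⁻ f y∈ = f∈ x∈

  from : ∀ {y} → y ∈ˡ ys → y ∈ˡ map f xs
  from y∈ = subst (_∈ˡ map f xs) (fg y∈) (∈-map⁺ f (g∈ y∈))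

length-filter-split : {P Q : Pred A 0ℓ} (P? : Decidable P) (Q? : Decidable Q) (xs : List A) →
                      length (filter P? xs) ≡
                      length (filter (λ x → P? x ×-dec ¬? (Q? x)) xs) +
                      length (filter (λ x → P? x ×-dec Q? x) xs)
length-filter-split P? Q? [] = refl
length-filter-split P? Q? (x ∷ xs) with ih ← length-filter-split P? Q? xs | P? x | Q? x
... | no _  | _     = ih
... | yes _ | yes _ = trans (cong suc ih) (sym (ℕ.+-suc _ _))
... | yes _ | no _  = cong suc ih

module _ {R : A → B → Set} (R? : ∀ x y → Dec (R x y)) where

  private
    fibre : List A → B → ℕ
    fibre xs y = length (filter (λ x → R? x y) xs)

  sum-fibre-∷ : ∀ x xs ys → sum (map (fibre (x ∷ xs)) ys) ≡
                length (filter (R? x) ys) + sum (map (fibre xs) ys)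
  sum-fibre-∷ x xs [] = refl
  sum-fibre-∷ x xs (y ∷ ys) with ih ← sum-fibre-∷ x xs ys | R? x y
  ... | yes _ = cong suc (trans (cong (fibre xs y +_) ih)
                  (x∙yz≈y∙xz (fibre xs y) (length (filter (R? x) ys)) (sum (map (fibre xs) ys))))
  ... | no _  = trans (cong (fibre xs y +_) ih)
                  (x∙yz≈y∙xz (fibre xs y) (length (filter (R? x) ys)) (sum (map (fibre xs) ys)))

  -- Double counting of the related pairs: every row contributes one pair, and the right side
  -- collects the same pairs by columns.
  length≡sum-fibre : ∀ xs ys → (∀ {x} → x ∈ˡ xs → length (filter (R? x) ys) ≡ 1) →
                     length xs ≡ sum (map (λ y → length (filter (λ x → R? x y) xs)) ys)
  length≡sum-fibre [] ys one = sym (sum-zero ys)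
    where
    sum-zero : ∀ ys → sum (map (fibre []) ys) ≡ 0
    sum-zero []       = refl
    sum-zero (_ ∷ ys) = sum-zero ys
  length≡sum-fibre (x ∷ xs) ys one =
    trans (cong₂ _+_ (sym (one (here refl))) (length≡sum-fibre xs ys (one ∘ there)))
          (sym (sum-fibre-∷ x xs ys))

length-filter-unique : {P : Pred A 0ℓ} (P? : Decidable P) {xs : List A} → Unique xs →
                       ∀ {a} → a ∈ˡ xs → P a → (∀ {x} → x ∈ˡ xs → P x → x ≡ a) →
                       length (filter P? xs) ≡ 1
length-filter-unique P? {xs} uxs {a} a∈ pa only =
  length-set (Unique.filter⁺ P? uxs) ([] ∷ []) to from
  where
  to : ∀ {x} → x ∈ˡ filter P? xs → x ∈ˡ a ∷ []
  to x∈ with x∈xs , px ← ∈-filter⁻ P? x∈ = here (only x∈xs px)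

  from : ∀ {x} → x ∈ˡ a ∷ [] → x ∈ˡ filter P? xs
  from (here refl) = ∈-filter⁺ P? a∈ pa

length-cartesianProduct : (xs : List A) (ys : List B) →
                          length (cartesianProduct xs ys) ≡ length xs * length ys
length-cartesianProduct []       ys = refl
length-cartesianProduct (x ∷ xs) ys =
  trans (length-++ (map (x ,_) ys))
        (cong₂ _+_ (length-map (x ,_) ys) (length-cartesianProduct xs ys))

-- Used to pass from distinct to disjoint, an implication that holds between components but not
-- between arbitrary sets.
AllPairs-restrict : {P : Pred A 0ℓ} {R S : Rel A 0ℓ} →
                    (∀ {x y} → P x → P y → R x y → S x y) →
                    ∀ {xs} → All P xs → AllPairs R xs → AllPairs S xs
AllPairs-restrict f []         []         = []
AllPairs-restrict f (px ∷ pxs) (rx ∷ rxs) =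
  All.zipWith (λ (py , r) → f px py r) (pxs , rx) ∷ AllPairs-restrict f pxs rxs

sublists-⊆ : ∀ (xs : List A) {ys} → ys ∈ˡ sublists xs → ∀ {y} → y ∈ˡ ys → y ∈ˡ xs
sublists-⊆ [] (here refl) ()
sublists-⊆ (x ∷ xs) ys∈ y∈ with ∈-++⁻ (sublists xs) ys∈
... | inj₁ ys∈′ = there (sublists-⊆ xs ys∈′ y∈)
... | inj₂ ys∈′ with zs , zs∈ , refl ← ∈-map⁻ (x ∷_) ys∈′ with y∈
...   | here refl = here refl
...   | there y∈′ = there (sublists-⊆ xs zs∈ y∈′)

sublists-unique : {xs : List A} → Unique xs → Unique (sublists xs)
sublists-unique []                             = [] ∷ []
sublists-unique {xs = x ∷ xs} uxs@(_ ∷ uxs′) =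
  Unique.++⁺ (sublists-unique uxs′)
             (Unique.map⁺ (λ { refl → refl }) (sublists-unique uxs′)) disjoint
  where
  disjoint : ∀ {zs} → ¬ (zs ∈ˡ sublists xs × zs ∈ˡ map (x ∷_) (sublists xs))
  disjoint (zs∈ , zs∈′) with ys , _ , refl ← ∈-map⁻ (x ∷_) zs∈′ =
    Unique.Unique[x∷xs]⇒x∉xs uxs (sublists-⊆ xs zs∈ (here refl))

module _ {P : Pred A 0ℓ} (P? : Decidable P) where

  filter∈sublists : ∀ xs → filter P? xs ∈ˡ sublists xs
  filter∈sublists [] = here refl
  filter∈sublists (x ∷ xs) with ih ← filter∈sublists xs | P? x
  ... | yes _ = ∈-++⁺ʳ (sublists xs) (∈-map⁺ (x ∷_) ih)
  ... | no _  = ∈-++⁺ˡ ih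

  -- A sublist inherits the order of a repetition-free list, so its members determine it. Hence two
  -- decompositions with the same blocks are equal as lists.
  sublist≡filter : ∀ {xs} → Unique xs → ∀ {ys} → ys ∈ˡ sublists xs →
                   (∀ {x} → x ∈ˡ ys → P x) → (∀ {x} → x ∈ˡ xs → P x → x ∈ˡ ys) →
                   ys ≡ filter P? xs
  sublist≡filter {[]} _ (here refl) _ _ = refl
  sublist≡filter {x ∷ xs} uxs@(_ ∷ uxs′) ys∈ sound complete
    with ∈-++⁻ (sublists xs) ys∈
  ... | inj₁ ys∈′ = trans (sublist≡filter uxs′ ys∈′ sound (complete ∘ there))
      (sym (filter-reject P? λ px →
        Unique.Unique[x∷xs]⇒x∉xs uxs (sublists-⊆ xs ys∈′ (complete (here refl) px))))
  ... | inj₂ ys∈′ with zs , zs∈ , refl ← ∈-map⁻ (x ∷_) ys∈′ =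
    trans (cong (x ∷_) (sublist≡filter uxs′ zs∈ (sound ∘ there) complete′))
          (sym (filter-accept P? (sound (here refl))))
    where
    complete′ : ∀ {y} → y ∈ˡ xs → P y → y ∈ˡ zs
    complete′ y∈ py with complete (there y∈) py
    ... | here refl = contradiction y∈ (Unique.Unique[x∷xs]⇒x∉xs uxs)
    ... | there y∈zs = y∈zs

-- Finite subsets

∈-allSubsets : (p : Subset N) → p ∈ˡ allSubsets N
∈-allSubsets [] = here refl
∈-allSubsets (outside ∷ p) = ∈-++⁺ˡ (∈-map⁺ (outside ∷_) (∈-allSubsets p))
∈-allSubsets (inside ∷ p)  = ∈-++⁺ʳ (map (outside ∷_) (allSubsets _)) (∈-map⁺ (inside ∷_) (∈-allSubsets p))

allSubsets-unique : ∀ N → Unique (allSubsets N)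
allSubsets-unique zero    = [] ∷ []
allSubsets-unique (suc N) =
  Unique.++⁺ (Unique.map⁺ ∷-injectiveʳ (allSubsets-unique N))
             (Unique.map⁺ ∷-injectiveʳ (allSubsets-unique N)) disjoint
  where
  disjoint : ∀ {p} → ¬ (p ∈ˡ map (outside ∷_) (allSubsets N) × p ∈ˡ map (inside ∷_) (allSubsets N))
  disjoint (o∈ , i∈) with ∈-map⁻ (outside ∷_) o∈ | ∈-map⁻ (inside ∷_) i∈
  ... | _ , _ , refl | _ , _ , ()

∣p∪q∣≡∣p∣+∣q∣ : (p q : Subset N) → Empty (p ∩ q) → ∣ p ∪ q ∣ ≡ ∣ p ∣ + ∣ q ∣
∣p∪q∣≡∣p∣+∣q∣ []            []            _ = refl
∣p∪q∣≡∣p∣+∣q∣ (outside ∷ p) (outside ∷ q) d = ∣p∪q∣≡∣p∣+∣q∣ p q (drop-∷-Empty d)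
∣p∪q∣≡∣p∣+∣q∣ (inside ∷ p)  (outside ∷ q) d = cong suc (∣p∪q∣≡∣p∣+∣q∣ p q (drop-∷-Empty d))
∣p∪q∣≡∣p∣+∣q∣ (outside ∷ p) (inside ∷ q)  d =
  trans (cong suc (∣p∪q∣≡∣p∣+∣q∣ p q (drop-∷-Empty d))) (sym (ℕ.+-suc _ _))
∣p∪q∣≡∣p∣+∣q∣ (inside ∷ p)  (inside ∷ q)  d = contradiction (zero , here) d

x∈p-y⇒x∈p : (p : Subset N) {x y : Fin N} → x ∈ p - y → x ∈ p
x∈p-y⇒x∈p p {y = y} = p─q⊆p p ⁅ y ⁆

x∉p-x : (p : Subset N) (x : Fin N) → x ∉ p - x
x∉p-x (inside ∷ p) zero ()
x∉p-x (outside ∷ p) zero ()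
x∉p-x (_ ∷ p) (suc x) (there x∈) = x∉p-x p x x∈

x∈p-y⇒x≢y : (p : Subset N) {x y : Fin N} → x ∈ p - y → x ≢ y
x∈p-y⇒x≢y p x∈ refl = x∉p-x p _ x∈

p-x∪x : {p : Subset N} {x : Fin N} → x ∈ p → (p - x) ∪ ⁅ x ⁆ ≡ p
p-x∪x {p = p} {x} x∈p = ⊆-antisym to from
  where
  to : (p - x) ∪ ⁅ x ⁆ ⊆ p
  to y∈ with x∈p∪q⁻ (p - x) ⁅ x ⁆ y∈
  ... | inj₁ y∈p = x∈p-y⇒x∈p p y∈p
  ... | inj₂ y∈x with refl ← x∈⁅y⁆⇒x≡y x y∈x = x∈p

  from : p ⊆ (p - x) ∪ ⁅ x ⁆
  from {y} y∈p with y ≟ x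
  ... | yes refl = x∈p∪q⁺ (inj₂ (x∈⁅x⁆ x))
  ... | no y≢x   = x∈p∪q⁺ (inj₁ (x∈p∧x≢y⇒x∈p-y y∈p y≢x))

p∪x-x : {p : Subset N} {x : Fin N} → x ∉ p → (p ∪ ⁅ x ⁆) - x ≡ p
p∪x-x {p = p} {x} x∉p = ⊆-antisym to
  (λ y∈p → x∈p∧x≢y⇒x∈p-y (x∈p∪q⁺ (inj₁ y∈p)) λ { refl → x∉p y∈p })
  where
  to : (p ∪ ⁅ x ⁆) - x ⊆ p
  to y∈ with x∈p∪q⁻ p ⁅ x ⁆ (x∈p-y⇒x∈p (p ∪ ⁅ x ⁆) y∈)
  ... | inj₁ y∈p = y∈p
  ... | inj₂ y∈x = contradiction (x∈⁅y⁆⇒x≡y x y∈x) (x∈p-y⇒x≢y (p ∪ ⁅ x ⁆) y∈)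

∣p∪x∣≡1+∣p∣ : (p : Subset N) {x : Fin N} → x ∉ p → ∣ p ∪ ⁅ x ⁆ ∣ ≡ suc ∣ p ∣
∣p∪x∣≡1+∣p∣ p {x} x∉p = begin
  ∣ p ∪ ⁅ x ⁆ ∣       ≡⟨ ∣p∪q∣≡∣p∣+∣q∣ p ⁅ x ⁆ disjoint ⟩
  ∣ p ∣ + ∣ ⁅ x ⁆ ∣   ≡⟨ cong (∣ p ∣ +_) (∣⁅x⁆∣≡1 x) ⟩
  ∣ p ∣ + 1           ≡⟨ ℕ.+-comm ∣ p ∣ 1 ⟩
  suc ∣ p ∣           ∎
  where
  open ≡-Reasoning
  disjoint : Empty (p ∩ ⁅ x ⁆)
  disjoint (y , y∈) with y∈p , y∈x ← x∈p∩q⁻ p ⁅ x ⁆ y∈ with refl ← x∈⁅y⁆⇒x≡y x y∈x = x∉p y∈p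

∣p∣≡1+∣p-x∣ : (p : Subset N) {x : Fin N} → x ∈ p → ∣ p ∣ ≡ suc ∣ p - x ∣
∣p∣≡1+∣p-x∣ p {x} x∈p = trans (cong ∣_∣ (sym (p-x∪x x∈p))) (∣p∪x∣≡1+∣p∣ (p - x) (x∉p-x p x))

∣p∣≡1+n⇒Nonempty : (p : Subset N) {n : ℕ} → ∣ p ∣ ≡ suc n → Nonempty p
∣p∣≡1+n⇒Nonempty {N} p eq with nonempty? p
... | yes p≠∅ = p≠∅
... | no p=∅ with refl ← Empty-unique p=∅ = contradiction (trans (sym (∣⊥∣≡0 N)) eq) λ ()

∣p∣≡0⇒Empty : (p : Subset N) → ∣ p ∣ ≡ 0 → Empty p
∣p∣≡0⇒Empty p eq (x , x∈p) = contradiction (trans (sym (∣p∣≡1+∣p-x∣ p x∈p)) eq) λ ()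

∣p∣≡1⇒x≡y : (p : Subset N) → ∣ p ∣ ≡ 1 → ∀ {x y} → x ∈ p → y ∈ p → x ≡ y
∣p∣≡1⇒x≡y p eq {x} {y} x∈ y∈ with x ≟ y
... | yes x≡y = x≡y
... | no x≢y  = contradiction (x , x∈p∧x≢y⇒x∈p-y x∈ x≢y)
  (∣p∣≡0⇒Empty (p - y) (ℕ.suc-injective (trans (sym (∣p∣≡1+∣p-x∣ p y∈)) eq)))

∣p∣≡2⇒pair : (p : Subset N) → ∣ p ∣ ≡ 2 → ∃₂ λ u v → p ≡ ⁅ u ⁆ ∪ ⁅ v ⁆
∣p∣≡2⇒pair p ∣p∣≡2 with u , u∈ ← ∣p∣≡1+n⇒Nonempty p ∣p∣≡2
  with ∣p-u∣≡1 ← ℕ.suc-injective (trans (sym (∣p∣≡1+∣p-x∣ p u∈)) ∣p∣≡2)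
  with v , v∈ ← ∣p∣≡1+n⇒Nonempty (p - u) ∣p-u∣≡1 = u , v , ⊆-antisym to from
  where
  to : p ⊆ ⁅ u ⁆ ∪ ⁅ v ⁆
  to {x} x∈ with x ≟ u
  ... | yes refl = x∈p∪q⁺ (inj₁ (x∈⁅x⁆ u))
  ... | no x≢u with refl ← ∣p∣≡1⇒x≡y (p - u) ∣p-u∣≡1 (x∈p∧x≢y⇒x∈p-y x∈ x≢u) v∈ =
    x∈p∪q⁺ (inj₂ (x∈⁅x⁆ v))

  from : ⁅ u ⁆ ∪ ⁅ v ⁆ ⊆ p
  from x∈ with x∈p∪q⁻ ⁅ u ⁆ ⁅ v ⁆ x∈
  ... | inj₁ x∈u with refl ← x∈⁅y⁆⇒x≡y u x∈u = u∈
  ... | inj₂ x∈v with refl ← x∈⁅y⁆⇒x≡y v x∈v = x∈p-y⇒x∈p p v∈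

∃-maximum : (p : Subset N) → Nonempty p → ∃[ x ] x IsMaximumOf p
∃-maximum (s ∷ p) ne with nonempty? p
... | yes p≠∅ with x , x∈ , x-max ← ∃-maximum p p≠∅ = suc x , there x∈ , suc-max
  where
  suc-max : ∀ y → y ∈ s ∷ p → y Fin.≤ suc x
  suc-max zero    _          = ℕ.z≤n
  suc-max (suc y) (there y∈) = ℕ.s≤s (x-max y y∈)
∃-maximum (s ∷ p) (suc x , there x∈) | no p=∅ = contradiction (x , x∈) p=∅
∃-maximum (s ∷ p) (zero , here)      | no p=∅ = zero , here , zero-max
  where
  zero-max : ∀ y → y ∈ inside ∷ p → toℕ y ≤ 0
  zero-max zero    _          = ℕ.z≤n
  zero-max (suc y) (there y∈) = contradiction (y , y∈) p=∅

⊆-⋃ : {ps : List (Subset N)} {p : Subset N} → p ∈ˡ ps → p ⊆ ⋃ ps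
⊆-⋃ (here refl) x∈ = x∈p∪q⁺ (inj₁ x∈)
⊆-⋃ (there p∈)  x∈ = x∈p∪q⁺ (inj₂ (⊆-⋃ p∈ x∈))

∈-⋃⁻ : (ps : List (Subset N)) {x : Fin N} → x ∈ ⋃ ps → ∃[ p ] p ∈ˡ ps × x ∈ p
∈-⋃⁻ []       x∈ = contradiction x∈ ∉⊥
∈-⋃⁻ (p ∷ ps) x∈ with x∈p∪q⁻ p (⋃ ps) x∈
... | inj₁ x∈p = p , here refl , x∈p
... | inj₂ x∈⋃ with q , q∈ , x∈q ← ∈-⋃⁻ ps x∈⋃ = q , there q∈ , x∈q

Disjoint : Rel (Subset N) 0ℓ
Disjoint p q = Empty (p ∩ q)

disjoint-blocks-≡ : {ps : List (Subset N)} → AllPairs Disjoint ps →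
                    ∀ {p q x} → p ∈ˡ ps → q ∈ˡ ps → x ∈ p → x ∈ q → p ≡ q
disjoint-blocks-≡ _       (here refl) (here refl) _ _ = refl
disjoint-blocks-≡ (d ∷ _) (here refl) (there q∈) x∈p x∈q =
  contradiction (_ , x∈p∩q⁺ (x∈p , x∈q)) (All.lookup d q∈)
disjoint-blocks-≡ (d ∷ _) (there p∈) (here refl) x∈p x∈q =
  contradiction (_ , x∈p∩q⁺ (x∈q , x∈p)) (All.lookup d p∈)
disjoint-blocks-≡ (_ ∷ d) (there p∈) (there q∈) = disjoint-blocks-≡ d p∈ q∈

-- Cyclic order on indices

next-inject₁ : ∀ {n} (i : Fin n) → next (inject₁ i) ≡ suc i
next-inject₁ {n} i = Fin.toℕ-injective (begin
  toℕ (next (inject₁ i))             ≡⟨ Fin.toℕ-fromℕ< _ ⟩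
  suc (toℕ (inject₁ i)) ℕ.% suc n    ≡⟨ cong (λ t → suc t ℕ.% suc n) (Fin.toℕ-inject₁ i) ⟩
  suc (toℕ i) ℕ.% suc n              ≡⟨ m<n⇒m%n≡m (ℕ.s≤s (Fin.toℕ<n i)) ⟩
  suc (toℕ i)                        ∎)
  where open ≡-Reasoning

next-fromℕ : ∀ n → next (fromℕ n) ≡ zero
next-fromℕ n = Fin.toℕ-injective (begin
  toℕ (next (fromℕ n))               ≡⟨ Fin.toℕ-fromℕ< _ ⟩
  suc (toℕ (fromℕ n)) ℕ.% suc n      ≡⟨ cong (λ t → suc t ℕ.% suc n) (Fin.toℕ-fromℕ n) ⟩
  suc n ℕ.% suc n                    ≡⟨ n%n≡0 (suc n) ⟩
  0                                  ∎)
  where open ≡-Reasoning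

toℕ-next : ∀ {n} (i : Fin (suc n)) →
           toℕ (next i) ≡ suc (toℕ i) ⊎ (toℕ i ≡ n × toℕ (next i) ≡ 0)
toℕ-next {n} i with view i
... | ‵fromℕ     = inj₂ (Fin.toℕ-fromℕ n , cong toℕ (next-fromℕ n))
... | ‵inject₁ j = inj₁ (trans (cong toℕ (next-inject₁ j)) (cong suc (sym (Fin.toℕ-inject₁ j))))

-- This is where cycles need at least three vertices: on two vertices the two steps would run along
-- the same edge.
next-next≢ : ∀ {k} (i : Fin (3 + k)) → next (next i) ≢ i
next-next≢ i eq with i⁺⁺ ← cong toℕ eq | toℕ-next i | toℕ-next (next i)
... | inj₁ a       | inj₁ b       = ℕ.m≢1+n+m (toℕ i) (trans (sym i⁺⁺) (trans b (cong suc a)))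
... | inj₁ a       | inj₂ (b , z) =
  contradiction (trans (sym b) (trans a (cong suc (trans (sym i⁺⁺) z)))) λ ()
... | inj₂ (a , z) | inj₁ b       =
  contradiction (trans (sym a) (trans (sym i⁺⁺) (trans b (cong suc z)))) λ ()
... | inj₂ (a , z) | inj₂ (b , _) = contradiction (trans (sym z) b) λ ()

-- The long way round a cycle with the step at `j` left out: backwards from `j` to index zero,
-- across to the top index, and down again to `next j`.
go-around : ∀ {n} {R : Rel (Fin (suc n)) 0ℓ} → Symmetric R → ∀ j →
            (∀ i → i ≢ j → R i (next i)) → Star R j (next j)
go-around {n} {R} R-sym j good with view j
... | ‵fromℕ = subst (Star R (fromℕ n)) (sym (next-fromℕ n))
  (<-weakInduction (λ i → Star R i zero) ε
    (λ i path → R-sym (subst (R (inject₁ i)) (next-inject₁ i)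
                        (good (inject₁ i) (Fin.fromℕ≢inject₁ ∘ sym))) ◅ path)
    (fromℕ n))
... | ‵inject₁ j = subst (Star R (inject₁ j)) (sym (next-inject₁ j))
  (down (inject₁ j) (ℕ.≤-reflexive (Fin.toℕ-inject₁ j))
   ◅◅ (R-sym (subst (R (fromℕ n)) (next-fromℕ n) (good (fromℕ n) Fin.fromℕ≢inject₁))
       ◅ up (suc j) ℕ.≤-refl))
  where
  back : ∀ i → toℕ i ≢ toℕ j → R (suc i) (inject₁ i)
  back i i≢j = R-sym (subst (R (inject₁ i)) (next-inject₁ i)
    (good (inject₁ i) (i≢j ∘ cong toℕ ∘ Fin.inject₁-injective)))

  down : ∀ i → toℕ i ℕ.≤ toℕ j → Star R i zero
  down = <-weakInduction (λ i → toℕ i ℕ.≤ toℕ j → Star R i zero) (λ _ → ε)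
    λ i path i<j → back i (ℕ.<⇒≢ i<j) ◅
      path (ℕ.≤-trans (ℕ.≤-reflexive (Fin.toℕ-inject₁ i)) (ℕ.<⇒≤ i<j))

  up : ∀ i → toℕ j ℕ.< toℕ i → Star R (fromℕ n) i
  up = >-weakInduction (λ i → toℕ j ℕ.< toℕ i → Star R (fromℕ n) i) (λ _ → ε)
    λ i path j<i → let j<i′ = subst (toℕ j ℕ.<_) (Fin.toℕ-inject₁ i) j<i in
      path (ℕ.m<n⇒m<1+n j<i′) ◅◅ back i (ℕ.<⇒≢ j<i′ ∘ sym) ◅ ε

-- Simple paths

data SimplePath (R : Rel (Fin N) 0ℓ) (w : Fin N) : ∀ {m} → Vec (Fin N) (suc m) → Set where
  stop : SimplePath R w (w ∷ [])
  step : ∀ {m x y} {ys : Vec (Fin N) m} → R x y → ¬ VecAny.Any (x ≡_) (y ∷ ys) →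
         SimplePath R w (y ∷ ys) → SimplePath R w (x ∷ y ∷ ys)

module _ {R : Rel (Fin N) 0ℓ} {w : Fin N} where

  shorten : ∀ {m} {xs : Vec (Fin N) (suc m)} → SimplePath R w xs → ∀ {x} → VecAny.Any (x ≡_) xs →
            ∃[ k ] ∃[ ys ] SimplePath R w {k} (x ∷ ys)
  shorten stop                (VecAny.here refl) = _ , _ , stop
  shorten p@(step _ _ _)      (VecAny.here refl) = _ , _ , p
  shorten (step _ _ p)        (VecAny.there x∈)  = shorten p x∈

  -- Loop erasure: if `u` recurs on the already simplified rest, everything before that occurrence
  -- is dropped.
  simplify : ∀ {u} → Star R u w → ∃[ k ] ∃[ ys ] SimplePath R w {k} (u ∷ ys)
  simplify ε = _ , _ , stop
  simplify {u} (_◅_ {j = x} r path) with k , ys , p ← simplify path | VecAny.any? (u ≟_) (x ∷ ys)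
  ... | yes u∈ = shorten p u∈
  ... | no u∉  = _ , _ , step r u∉ p

  simplePath-unique : ∀ {m} {xs : Vec (Fin N) (suc m)} → SimplePath R w xs → UniqueVec xs
  simplePath-unique stop          = VecAll.[] VecAllPairs.∷ VecAllPairs.[]
  simplePath-unique (step _ x∉ p) = VecAll¬ x∉ VecAllPairs.∷ simplePath-unique p
    where
    VecAll¬ : ∀ {x m} {xs : Vec (Fin N) m} → ¬ VecAny.Any (x ≡_) xs → VecAll.All (x ≢_) xs
    VecAll¬ {xs = []}     _ = VecAll.[]
    VecAll¬ {xs = _ ∷ _} x∉ = (x∉ ∘ VecAny.here) VecAll.∷ VecAll¬ (x∉ ∘ VecAny.there)

  simplePath-last : ∀ {m} {xs : Vec (Fin N) (suc m)} → SimplePath R w xs → lookup xs (fromℕ m) ≡ w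
  simplePath-last stop         = refl
  simplePath-last (step _ _ p) = simplePath-last p

  simplePath-step : ∀ {m} {xs : Vec (Fin N) (suc m)} → SimplePath R w xs →
                    ∀ i → R (lookup xs (inject₁ i)) (lookup xs (suc i))
  simplePath-step (step r _ _) zero    = r
  simplePath-step (step _ _ p) (suc i) = simplePath-step p i

-- Broken cycles and paths

-- The edge predicate is a parameter because two kinds of paths occur: through all of `F`, for its
-- components, and through the edges of `F` below a given edge, for broken cycles.
Link : OrderedGraph N M → Pred (Fin M) 0ℓ → Rel (Fin N) 0ℓ
Link G P u v = ∃[ f ] (P f × Joins G f u v)

Path : OrderedGraph N M → Pred (Fin M) 0ℓ → Rel (Fin N) 0ℓ
Path G P = Star (Link G P)

module _ (G : OrderedGraph N M) where

  joins-sym : ∀ {e u v} → Joins G e u v → Joins G e v u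
  joins-sym (e∈ , eq) = e∈ , trans eq (∪-comm _ _)

  joins⇒∈ends : ∀ {e u v} → Joins G e u v → u ∈ ends G e
  joins⇒∈ends {u = u} (_ , eq) = subst (u ∈_) (sym eq) (x∈p∪q⁺ (inj₁ (x∈⁅x⁆ u)))

  joins⇒≢ : ∀ {e u v} → Joins G e u v → u ≢ v
  joins⇒≢ {e} {u} (_ , eq) refl = contradiction
    (trans (sym (∣ends∣≡2 G e)) (trans (cong ∣_∣ (trans eq (∪-idem _))) (∣⁅x⁆∣≡1 u))) λ ()

  ∈ends⇒≡ : ∀ {e u v x} → Joins G e u v → x ∈ ends G e → x ≡ u ⊎ x ≡ v
  ∈ends⇒≡ {u = u} {v} (_ , eq) x∈ with x∈p∪q⁻ ⁅ u ⁆ ⁅ v ⁆ (subst (_ ∈_) eq x∈)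
  ... | inj₁ x∈u = inj₁ (x∈⁅y⁆⇒x≡y u x∈u)
  ... | inj₂ x∈v = inj₂ (x∈⁅y⁆⇒x≡y v x∈v)

  joins-injective : ∀ {e f u v} → Joins G e u v → Joins G f u v → e ≡ f
  joins-injective (_ , eq) (_ , eq′) = ends-injective G (trans eq (sym eq′))

  ∃-joins : ∀ {e} → e ∈ E G → ∃₂ λ u v → Joins G e u v
  ∃-joins {e} e∈ with u , v , eq ← ∣p∣≡2⇒pair (ends G e) (∣ends∣≡2 G e) = u , v , e∈ , eq

  joins⇒∈V : ∀ {e u v} → Joins G e u v → u ∈ V G
  joins⇒∈V j = ends⊆V G (proj₁ j) (joins⇒∈ends j)

  link-sym : ∀ {P} → Symmetric (Link G P)
  link-sym (f , pf , j) = f , pf , joins-sym j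

  -- An edge at two positions is traversed either in the same direction, so that distinctness of the
  -- vertices gives `i ≡ j`, or in opposite directions, which forces `next (next j) ≡ j`.
  cycle-edge-injective : ∀ {k} {v : Vec (Fin N) (3 + k)} → UniqueVec v → ∀ {e i j} →
                         Joins G e (lookup v i) (lookup v (next i)) →
                         Joins G e (lookup v j) (lookup v (next j)) → i ≡ j
  cycle-edge-injective {v = v} uv {i = i} {j} at-i at-j
    with ∈ends⇒≡ at-j (joins⇒∈ends at-i) | ∈ends⇒≡ at-j (joins⇒∈ends (joins-sym at-i))
  ... | inj₁ eq | _        = lookup-injective uv i j eq
  ... | inj₂ eq | inj₂ eq′ = contradiction (trans eq (sym eq′)) (joins⇒≢ at-i)
  ... | inj₂ eq | inj₁ eq′
    with refl ← lookup-injective uv i (next j) eq =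
    contradiction (lookup-injective uv _ _ eq′) (next-next≢ j)

-- Kruskal's criterion for F to contain no broken cycle.
NoBrokenPath : OrderedGraph N M → Subset M → Set
NoBrokenPath G F = ∀ {e u v} → Joins G e u v → ¬ Path G (λ f → f ∈ F × f Fin.< e) u v

-- With its maximal edge `e` removed, a cycle is still a walk between the ends of `e`, and all its
-- remaining edges are smaller than `e`.
noBrokenPath⇒noBrokenCycle : (G : OrderedGraph N M) (F : Subset M) →
                             NoBrokenPath G F → ContainsNoBrokenCycle G F
noBrokenPath⇒noBrokenCycle G F nbp B (C , (k , v , uv , link , edge) , e , (e∈C , e-max) , refl) B⊆F
  with j , e-at-j ← edge e e∈C =
  nbp e-at-j (Star.gmap (lookup v) id (go-around {R = R} (link-sym G) j good))
  where
  R : Rel (Fin (3 + k)) 0ℓ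
  R i i′ = Link G (λ f → f ∈ F × f Fin.< e) (lookup v i) (lookup v i′)

  good : ∀ i → i ≢ j → R i (next i)
  good i i≢j with f , f∈C , f-at-i ← link i =
    f , (B⊆F (x∈p∧x≢y⇒x∈p-y f∈C f≢e) , Fin.≤∧≢⇒< (e-max f f∈C) f≢e) , f-at-i
    where
    f≢e : f ≢ e
    f≢e refl = i≢j (cycle-edge-injective G uv f-at-i e-at-j)

-- A simple path between the ends of `e` is closed by `e` to a cycle with maximum `e`. The two short
-- cases are impossible: `e` is not a loop, and an edge parallel to `e` would be `e` itself. So at
-- least three vertices remain.
noBrokenCycle⇒noBrokenPath : (G : OrderedGraph N M) (F : Subset M) →
                             ContainsNoBrokenCycle G F → NoBrokenPath G F
noBrokenCycle⇒noBrokenPath {N} {M} G F nbc {e} {u} {v} e-joins path with simplify path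
... | _ , _ , stop = joins⇒≢ G e-joins refl
... | _ , _ , step (f , (_ , f<e) , f-joins) _ stop =
  Fin.<⇒≢ f<e (joins-injective G f-joins e-joins)
... | suc (suc k) , ys , p@(step _ _ (step _ _ _)) =
  nbc (C - e) (C , (k , vs , uvs , linked , λ f → ∈-comprehension⁻ onCycle?) ,
           e , (e∈C , e-max) , refl) C-e⊆F
  where
  vs : Vec (Fin N) (3 + k)
  vs = u ∷ ys

  uvs : UniqueVec vs
  uvs = simplePath-unique p

  OnCycle : Pred (Fin M) 0ℓ
  OnCycle f = ∃[ i ] Joins G f (lookup vs i) (lookup vs (next i))

  onCycle? : Decidable OnCycle
  onCycle? f = any? λ i → joins? G f (lookup vs i) (lookup vs (next i))

  -- Edges are determined by their ends, so this contains nothing beyond `e` and the edges that the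
  -- path uses.
  C : Subset M
  C = comprehension onCycle?

  -- `e` sits at the wrap-around position, from the last vertex `v` back to `u`.
  e-closes : Joins G e (lookup vs (fromℕ (2 + k))) (lookup vs (next (fromℕ (2 + k))))
  e-closes rewrite next-fromℕ (2 + k) | simplePath-last p = joins-sym G e-joins

  step-at : ∀ i → Link G (λ f → f ∈ F × f Fin.< e) (lookup vs (inject₁ i)) (lookup vs (next (inject₁ i)))
  step-at i rewrite next-inject₁ i = simplePath-step p i

  linked : ∀ i → ∃[ f ] (f ∈ C × Joins G f (lookup vs i) (lookup vs (next i)))
  linked i = let f , j = link i in f , ∈-comprehension⁺ onCycle? (i , j) , j
    where
    link : ∀ i → ∃[ f ] Joins G f (lookup vs i) (lookup vs (next i))
    link i with view i
    ... | ‵fromℕ     = e , e-closes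
    ... | ‵inject₁ i with f , _ , j ← step-at i = f , j

  C⊆F∪e : ∀ f → f ∈ C → f ≡ e ⊎ (f ∈ F × f Fin.< e)
  C⊆F∪e f f∈C with i , j ← ∈-comprehension⁻ onCycle? f∈C with view i
  ... | ‵fromℕ     = inj₁ (joins-injective G j e-closes)
  ... | ‵inject₁ i with g , g∈ , g-joins ← step-at i with refl ← joins-injective G j g-joins = inj₂ g∈

  e∈C : e ∈ C
  e∈C = ∈-comprehension⁺ onCycle? (fromℕ (2 + k) , e-closes)

  e-max : ∀ f → f ∈ C → f Fin.≤ e
  e-max f f∈C with C⊆F∪e f f∈C
  ... | inj₁ refl      = ℕ.≤-refl
  ... | inj₂ (_ , f<e) = ℕ.<⇒≤ f<e

  C-e⊆F : C - e ⊆ F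
  C-e⊆F {f} f∈ with C⊆F∪e f (x∈p-y⇒x∈p C f∈)
  ... | inj₁ refl      = contradiction f∈ (x∉p-x C e)
  ... | inj₂ (f∈F , _) = f∈F

-- Induced subgraphs

module _ (G : OrderedGraph N M) {W : Subset N} where

  ∈E[]⁺ : ∀ {e} → e ∈ E G → ends G e ⊆ W → e ∈ E (G [ W ])
  ∈E[]⁺ e∈ e⊆W = ∈-comprehension⁺ (λ e → (e ∈? E G) ×-dec (ends G e ⊆? W)) (e∈ , e⊆W)

  ∈E[]⁻ : ∀ {e} → e ∈ E (G [ W ]) → e ∈ E G × ends G e ⊆ W
  ∈E[]⁻ = ∈-comprehension⁻ (λ e → (e ∈? E G) ×-dec (ends G e ⊆? W))

  joins[]⁺ : ∀ {e u v} → Joins G e u v → u ∈ W → v ∈ W → Joins (G [ W ]) e u v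
  joins[]⁺ {e} j@(e∈ , eq) u∈ v∈ = ∈E[]⁺ e∈ ends⊆ , eq
    where
    ends⊆ : ends G e ⊆ W
    ends⊆ x∈ with ∈ends⇒≡ G j x∈
    ... | inj₁ refl = u∈
    ... | inj₂ refl = v∈

  joins[]⁻ : ∀ {e u v} → Joins (G [ W ]) e u v → Joins G e u v
  joins[]⁻ (e∈ , eq) = proj₁ (∈E[]⁻ e∈) , eq

-- root picks one vertex in each connected component of the forest (V G , F);
-- the saturated sets are the unions of components.
record Rooting (G : OrderedGraph N M) (F : Subset M) : Set where
  field
    root       : Fin N → Fin N
    root∈V     : ∀ {v} → v ∈ V G → root v ∈ V G
    root-idem  : ∀ v → root (root v) ≡ root v
    joins⇒root≡ : ∀ {f u v} → f ∈ F → Joins G f u v → root u ≡ root v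
    root≡⇒path : ∀ {u v} → u ∈ V G → v ∈ V G → root u ≡ root v → Path G (_∈ F) u v

  roots : Subset N
  roots = comprehension (λ x → root x ≟ x)

  Saturated : Subset N → Set
  Saturated X = ∀ {x y} → x ∈ X → y ∈ V G → root x ≡ root y → y ∈ X

  field
    -- Edges plus components equals vertices, with `roots` standing for the components. It is
    -- required of all saturated sets at once because a component that arises by adding an edge is a
    -- union of two earlier ones.
    count : ∀ {X} → X ⊆ V G → Saturated X → ∣ F ∩ E (G [ X ]) ∣ + ∣ X ∩ roots ∣ ≡ ∣ X ∣

emptyRooting : (G : OrderedGraph N M) {F : Subset M} → Empty F → Rooting G F
emptyRooting {N} {M} G {F} F=∅ = record
  { root        = id
  ; root∈V      = id
  ; root-idem   = λ _ → refl
  ; joins⇒root≡ = λ f∈F _ → contradiction (_ , f∈F) F=∅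
  ; root≡⇒path  = λ { _ _ refl → ε }
  ; count       = λ {X} _ _ → cong₂ _+_
      (trans (cong ∣_∣ (Empty-unique λ (f , f∈) → F=∅ (f , proj₁ (x∈p∩q⁻ F _ f∈)))) (∣⊥∣≡0 M))
      (cong ∣_∣ (⊆-antisym (p∩q⊆p X _) λ x∈ → x∈p∩q⁺ (x∈ , ∈-comprehension⁺ (λ x → x ≟ x) refl)))
  }

module _ {G : OrderedGraph N M} {F : Subset M} {f : Fin M} (f∈F : f ∈ F) {a b : Fin N}
         (f-joins : Joins G f a b) (T : Rooting G (F - f)) where

  open Rooting T

  private
    redirect : Fin N → Fin N
    redirect z = if does (z ≟ root a) then root b else z

    redirect-≡ : ∀ {z} → z ≡ root a → redirect z ≡ root b
    redirect-≡ {z} eq rewrite dec-true (z ≟ root a) eq = refl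

    redirect-≢ : ∀ {z} → z ≢ root a → redirect z ≡ z
    redirect-≢ {z} neq rewrite dec-false (z ≟ root a) neq = refl

  -- The component of `a` is merged into that of `b` by redirecting `root a` to `root b`. A
  -- saturated set containing `a` gains the edge `f` and loses the root `root a`; for the others
  -- both counts are unchanged.
  addEdge : root a ≢ root b → Rooting G F
  addEdge ra≢rb = record
    { root        = root′
    ; root∈V      = root′∈V
    ; root-idem   = idem
    ; joins⇒root≡ = λ {g} g∈F j → joins⇒ g g∈F j
    ; root≡⇒path  = path
    ; count       = λ {X} → count′ X
    }
    where
    root′ : Fin N → Fin N
    root′ x = redirect (root x)

    root′b : root′ b ≡ root b
    root′b = redirect-≢ (ra≢rb ∘ sym)

    root′∈V : ∀ {v} → v ∈ V G → root′ v ∈ V G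
    root′∈V {v} v∈ with root v ≟ root a
    ... | yes _ = root∈V (joins⇒∈V G (joins-sym G f-joins))
    ... | no _  = root∈V v∈

    idem : ∀ v → root′ (root′ v) ≡ root′ v
    idem v with root v ≟ root a
    ... | yes _ = trans (cong redirect (root-idem b)) root′b
    ... | no neq = trans (cong redirect (root-idem v)) (redirect-≢ neq)

    joins⇒ : ∀ g → g ∈ F → ∀ {u v} → Joins G g u v → root′ u ≡ root′ v
    joins⇒ g g∈F j with g ≟ f
    ... | no g≢f = cong redirect (joins⇒root≡ (x∈p∧x≢y⇒x∈p-y g∈F g≢f) j)
    ... | yes refl with ∈ends⇒≡ G f-joins (joins⇒∈ends G j)
                  | ∈ends⇒≡ G f-joins (joins⇒∈ends G (joins-sym G j))
    ...   | inj₁ refl | inj₁ refl = refl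
    ...   | inj₁ refl | inj₂ refl = trans (redirect-≡ refl) (sym root′b)
    ...   | inj₂ refl | inj₁ refl = trans root′b (sym (redirect-≡ refl))
    ...   | inj₂ refl | inj₂ refl = refl

    weaken : ∀ {u v} → Path G (_∈ F - f) u v → Path G (_∈ F) u v
    weaken = Star.map λ (g , g∈ , j) → g , x∈p-y⇒x∈p F g∈ , j

    a∈V : a ∈ V G
    a∈V = joins⇒∈V G f-joins

    b∈V : b ∈ V G
    b∈V = joins⇒∈V G (joins-sym G f-joins)

    path : ∀ {u v} → u ∈ V G → v ∈ V G → root′ u ≡ root′ v → Path G (_∈ F) u v
    path {u} {v} u∈ v∈ eq with root u ≟ root a | root v ≟ root a
    ... | yes p | yes q = weaken (root≡⇒path u∈ v∈ (trans p (sym q)))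
    -- Only `u` was redirected, so `eq` says that `v` was already in the component of `b`; the path
    -- has to cross `f`.
    ... | yes p | no _  =
      weaken (root≡⇒path u∈ a∈V p) ◅◅ (f , f∈F , f-joins) ◅ weaken (root≡⇒path b∈V v∈ eq)
    ... | no _  | yes q =
      weaken (root≡⇒path u∈ b∈V eq) ◅◅ (f , f∈F , joins-sym G f-joins) ◅ weaken (root≡⇒path a∈V v∈ (sym q))
    ... | no _  | no _  = weaken (root≡⇒path u∈ v∈ eq)

    roots′ : Subset N
    roots′ = comprehension (λ x → root′ x ≟ x)

    count′ : ∀ X → X ⊆ V G → (∀ {x y} → x ∈ X → y ∈ V G → root′ x ≡ root′ y → y ∈ X) →
             ∣ F ∩ E (G [ X ]) ∣ + ∣ X ∩ roots′ ∣ ≡ ∣ X ∣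
    count′ X X⊆V sat with a ∈? X
    ... | no a∉X = trans (cong₂ _+_ (cong ∣_∣ edges≡) (cong ∣_∣ roots≡)) (count X⊆V sat-T)
      where
      sat-T : Saturated X
      sat-T x∈ y∈ eq = sat x∈ y∈ (cong redirect eq)

      edges≡ : F ∩ E (G [ X ]) ≡ (F - f) ∩ E (G [ X ])
      edges≡ = ⊆-antisym
        (λ {g} g∈ → let g∈F , g∈E = x∈p∩q⁻ F _ g∈ in
          x∈p∩q⁺ (x∈p∧x≢y⇒x∈p-y g∈F
            (λ { refl → a∉X (proj₂ (∈E[]⁻ G g∈E) (joins⇒∈ends G f-joins)) }) , g∈E))
        (λ {g} g∈ → let g∈F , g∈E = x∈p∩q⁻ (F - f) _ g∈ in x∈p∩q⁺ (x∈p-y⇒x∈p F g∈F , g∈E))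

      root′≡ : ∀ {x} → x ∈ X → root′ x ≡ root x
      root′≡ x∈ = redirect-≢ λ eq → a∉X (sat x∈ a∈V (cong redirect eq))

      roots≡ : X ∩ roots′ ≡ X ∩ roots
      roots≡ = ⊆-antisym
        (λ x∈ → let x∈X , r = x∈p∩q⁻ X _ x∈ in
          x∈p∩q⁺ (x∈X , ∈-comprehension⁺ (λ x → root x ≟ x)
            (trans (sym (root′≡ x∈X)) (∈-comprehension⁻ (λ x → root′ x ≟ x) r))))
        (λ x∈ → let x∈X , r = x∈p∩q⁻ X _ x∈ in
          x∈p∩q⁺ (x∈X , ∈-comprehension⁺ (λ x → root′ x ≟ x)
            (trans (root′≡ x∈X) (∈-comprehension⁻ (λ x → root x ≟ x) r))))
    ... | yes a∈X = begin
      ∣ F ∩ E (G [ X ]) ∣ + ∣ X ∩ roots′ ∣                ≡⟨ cong (_+ ∣ X ∩ roots′ ∣) edges ⟩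
      suc ∣ (F - f) ∩ E (G [ X ]) ∣ + ∣ X ∩ roots′ ∣      ≡⟨ ℕ.+-suc _ _ ⟨
      ∣ (F - f) ∩ E (G [ X ]) ∣ + suc ∣ X ∩ roots′ ∣      ≡⟨ cong (∣ (F - f) ∩ E (G [ X ]) ∣ +_) roots-count ⟨
      ∣ (F - f) ∩ E (G [ X ]) ∣ + ∣ X ∩ roots ∣           ≡⟨ count X⊆V sat-T ⟩
      ∣ X ∣                                               ∎
      where
      open ≡-Reasoning

      -- Vertices with equal old roots have equal new roots, so a union of new components is also a
      -- union of old ones.
      sat-T : Saturated X
      sat-T x∈ y∈ eq = sat x∈ y∈ (cong redirect eq)

      b∈X : b ∈ X
      b∈X = sat a∈X b∈V (trans (redirect-≡ refl) (sym root′b))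

      f∈ : f ∈ F ∩ E (G [ X ])
      f∈ = x∈p∩q⁺ (f∈F , proj₁ (joins[]⁺ G f-joins a∈X b∈X))

      edges : ∣ F ∩ E (G [ X ]) ∣ ≡ suc ∣ (F - f) ∩ E (G [ X ]) ∣
      edges = trans (∣p∣≡1+∣p-x∣ (F ∩ E (G [ X ])) f∈) (cong (suc ∘ ∣_∣) (⊆-antisym
        (λ g∈ → let g∈F , g∈E = x∈p∩q⁻ F _ (x∈p-y⇒x∈p _ g∈) in
          x∈p∩q⁺ (x∈p∧x≢y⇒x∈p-y g∈F (x∈p-y⇒x≢y (F ∩ E (G [ X ])) g∈) , g∈E))
        (λ g∈ → let g∈F , g∈E = x∈p∩q⁻ (F - f) _ g∈ in
          x∈p∧x≢y⇒x∈p-y (x∈p∩q⁺ (x∈p-y⇒x∈p F g∈F , g∈E)) (x∈p-y⇒x≢y F g∈F))))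

      ra∈ : root a ∈ X ∩ roots
      ra∈ = x∈p∩q⁺ (sat-T a∈X (root∈V a∈V) (sym (root-idem a)) ,
                    ∈-comprehension⁺ (λ x → root x ≟ x) (root-idem a))

      to : X ∩ roots - root a ⊆ X ∩ roots′
      to {x} x∈ with x∈X , r ← x∈p∩q⁻ X _ (x∈p-y⇒x∈p _ x∈)
        with rx≡x ← ∈-comprehension⁻ (λ x → root x ≟ x) r =
        x∈p∩q⁺ (x∈X , ∈-comprehension⁺ (λ x → root′ x ≟ x)
          (trans (redirect-≢ (x∈p-y⇒x≢y (X ∩ roots) x∈ ∘ trans (sym rx≡x))) rx≡x))

      from : X ∩ roots′ ⊆ X ∩ roots - root a
      from {x} x∈ with x∈X , r ← x∈p∩q⁻ X _ x∈
        with r′x≡x ← ∈-comprehension⁻ (λ x → root′ x ≟ x) r with root x ≟ root a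
      -- Here `x` is `root b`, whose old root is `root b` and not `root a`.
      ... | yes rx≡ra = contradiction
          (trans (sym rx≡ra) (trans (cong root (sym r′x≡x)) (root-idem b))) ra≢rb
      ... | no rx≢ra = x∈p∧x≢y⇒x∈p-y
          (x∈p∩q⁺ (x∈X , ∈-comprehension⁺ (λ x → root x ≟ x) r′x≡x))
          (λ x≡ra → rx≢ra (trans r′x≡x x≡ra))

      roots-count : ∣ X ∩ roots ∣ ≡ suc ∣ X ∩ roots′ ∣
      roots-count = trans (∣p∣≡1+∣p-x∣ (X ∩ roots) ra∈) (cong (suc ∘ ∣_∣) (⊆-antisym to from))

NoBrokenPath-⊆ : (G : OrderedGraph N M) {F F′ : Subset M} → F′ ⊆ F →
                 NoBrokenPath G F → NoBrokenPath G F′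
NoBrokenPath-⊆ G F′⊆F nbp j = nbp j ∘ Star.map λ (f , (f∈ , f<e) , j′) → f , (F′⊆F f∈ , f<e) , j′

-- Inserting the edges in increasing order, each new edge is the largest
-- one so far, and its ends cannot be connected already.
noBrokenPath⇒Rooting : (G : OrderedGraph N M) (F : Subset M) → F ⊆ E G → NoBrokenPath G F → Rooting G F
noBrokenPath⇒Rooting {M = M} G F = rooting F (<-wellFounded ∣ F ∣)
  where
  rooting : ∀ F → Acc ℕ._<_ ∣ F ∣ → F ⊆ E G → NoBrokenPath G F → Rooting G F
  rooting F (acc smaller) F⊆E nbp with nonempty? F
  ... | no F=∅ = emptyRooting G F=∅
  ... | yes F≠∅ with f , f∈F , f-max ← ∃-maximum F F≠∅ with a , b , j ← ∃-joins G (F⊆E f∈F) =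
    addEdge f∈F j T λ ra≡rb →
      nbp j (Star.map below (Rooting.root≡⇒path T (joins⇒∈V G j) (joins⇒∈V G (joins-sym G j)) ra≡rb))
    where
    T : Rooting G (F - f)
    T = rooting (F - f) (smaller (x∈p⇒∣p-x∣<∣p∣ f∈F)) (F⊆E ∘ x∈p-y⇒x∈p F)
                (NoBrokenPath-⊆ G (x∈p-y⇒x∈p F) nbp)

    below : ∀ {u v} → Link G (_∈ F - f) u v → Link G (λ g → g ∈ F × g Fin.< f) u v
    below (g , g∈ , j) = g , (x∈p-y⇒x∈p F g∈ , Fin.≤∧≢⇒< (f-max g (x∈p-y⇒x∈p F g∈)) (x∈p-y⇒x≢y F g∈)) , j

-- Components and decompositions

module _ {G : OrderedGraph N M} {F : Subset M} (T : Rooting G F) where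

  open Rooting T

  private
    sameRoot? : ∀ v → Decidable (λ x → x ∈ V G × root x ≡ root v)
    sameRoot? v x = (x ∈? V G) ×-dec (root x ≟ root v)

  component : Fin N → Subset N
  component v = comprehension (sameRoot? v)

  ∈-component⁺ : ∀ {v x} → x ∈ V G → root x ≡ root v → x ∈ component v
  ∈-component⁺ {v} x∈ eq = ∈-comprehension⁺ (sameRoot? v) (x∈ , eq)

  ∈-component⁻ : ∀ {v x} → x ∈ component v → x ∈ V G × root x ≡ root v
  ∈-component⁻ {v} = ∈-comprehension⁻ (sameRoot? v)

  component-cong : ∀ {v w} → root v ≡ root w → component v ≡ component w
  component-cong eq = ⊆-antisym
    (λ x∈ → let x∈V , r = ∈-component⁻ x∈ in ∈-component⁺ x∈V (trans r eq))
    (λ x∈ → let x∈V , r = ∈-component⁻ x∈ in ∈-component⁺ x∈V (trans r (sym eq)))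

  -- The instance of `count` at a single component, which contains exactly one root.
  component-edges : ∀ {v} → v ∈ V G → ∣ F ∩ E (G [ component v ]) ∣ + 1 ≡ ∣ component v ∣
  component-edges {v} v∈ = trans
    (cong (∣ F ∩ E (G [ component v ]) ∣ +_) (sym (trans (cong ∣_∣ one-root) (∣⁅x⁆∣≡1 (root v)))))
    (count (proj₁ ∘ ∈-component⁻) λ x∈ y∈ eq → ∈-component⁺ y∈ (trans (sym eq) (proj₂ (∈-component⁻ x∈))))
    where
    one-root : component v ∩ roots ≡ ⁅ root v ⁆
    one-root = ⊆-antisym to from
      where
      to : component v ∩ roots ⊆ ⁅ root v ⁆
      to x∈ with x∈C , r ← x∈p∩q⁻ (component v) roots x∈
        with refl ← trans (sym (∈-comprehension⁻ (λ x → root x ≟ x) r)) (proj₂ (∈-component⁻ x∈C)) = x∈⁅x⁆ _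

      from : ⁅ root v ⁆ ⊆ component v ∩ roots
      from x∈ with refl ← x∈⁅y⁆⇒x≡y _ x∈ =
        x∈p∩q⁺ (∈-component⁺ (root∈V v∈) (root-idem v) , ∈-comprehension⁺ (λ x → root x ≟ x) (root-idem v))

  -- Equal roots yield a path in `F`, and membership in `W` is carried along it.
  closed⇒Saturated : ∀ {W} → W ⊆ V G → (∀ {x y} → x ∈ W → Link G (_∈ F) x y → y ∈ W) → Saturated W
  closed⇒Saturated {W} W⊆V closed x∈ y∈ eq = follow x∈ (root≡⇒path (W⊆V x∈) y∈ eq)
    where
    follow : ∀ {x y} → x ∈ W → Path G (_∈ F) x y → y ∈ W
    follow x∈ ε          = x∈
    follow x∈ (l ◅ path) = follow (closed x∈ l) path

  -- Comparing the size condition with `count` leaves one root in `W`, and a union of components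
  -- with one root is one component.
  saturated-tree≡component : ∀ {W v} → W ⊆ V G → Saturated W → ∣ F ∩ E (G [ W ]) ∣ + 1 ≡ ∣ W ∣ →
                             v ∈ W → W ≡ component v
  saturated-tree≡component {W} {v} W⊆V sat tree v∈ = ⊆-antisym to from
    where
    one-root : ∣ W ∩ roots ∣ ≡ 1
    one-root = ℕ.+-cancelˡ-≡ ∣ F ∩ E (G [ W ]) ∣ _ _ (trans (count W⊆V sat) (sym tree))

    root∈ : ∀ {x} → x ∈ W → root x ∈ W ∩ roots
    root∈ {x} x∈ = x∈p∩q⁺ (sat x∈ (root∈V (W⊆V x∈)) (sym (root-idem x)) ,
                           ∈-comprehension⁺ (λ x → root x ≟ x) (root-idem x))

    to : W ⊆ component v
    to x∈ = ∈-component⁺ (W⊆V x∈) (∣p∣≡1⇒x≡y _ one-root (root∈ x∈) (root∈ v∈))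

    from : component v ⊆ W
    from x∈ = let x∈V , r = ∈-component⁻ x∈ in sat v∈ x∈V (sym r)

-- Edge sets lying within the blocks of a decomposition

edgesWithin : OrderedGraph N M → List (Subset N) → Subset M
edgesWithin G Vs = ⋃ (map (λ W → E (G [ W ])) Vs)

module _ (G : OrderedGraph N M) where

  ∈-edgesWithin⁺ : ∀ {Vs W} → W ∈ˡ Vs → E (G [ W ]) ⊆ edgesWithin G Vs
  ∈-edgesWithin⁺ W∈ = ⊆-⋃ (∈-map⁺ (λ W → E (G [ W ])) W∈)

  ∈-edgesWithin⁻ : ∀ Vs {f} → f ∈ edgesWithin G Vs → ∃[ W ] W ∈ˡ Vs × f ∈ E (G [ W ])
  ∈-edgesWithin⁻ Vs f∈ with _ , p∈ , f∈p ← ∈-⋃⁻ (map (λ W → E (G [ W ])) Vs) f∈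
    with W , W∈ , refl ← ∈-map⁻ (λ W → E (G [ W ])) p∈ = W , W∈ , f∈p

  E[]-disjoint : ∀ {W X} → Disjoint W X → Disjoint (E (G [ W ])) (E (G [ X ]))
  E[]-disjoint {W} {X} W∩X=∅ (f , f∈) with f∈W , f∈X ← x∈p∩q⁻ (E (G [ W ])) (E (G [ X ])) f∈
    with x , x∈f ← ∣p∣≡1+n⇒Nonempty (ends G f) (∣ends∣≡2 G f) =
    W∩X=∅ (x , x∈p∩q⁺ (proj₂ (∈E[]⁻ G f∈W) x∈f , proj₂ (∈E[]⁻ G f∈X) x∈f))

  edgesWithin-disjoint : ∀ {W Vs} → All (Disjoint W) Vs → Disjoint (E (G [ W ])) (edgesWithin G Vs)
  edgesWithin-disjoint {W} {Vs} d (f , f∈) with f∈W , f∈Vs ← x∈p∩q⁻ (E (G [ W ])) _ f∈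
    with X , X∈ , f∈X ← ∈-edgesWithin⁻ Vs f∈Vs = E[]-disjoint (All.lookup d X∈) (f , x∈p∩q⁺ (f∈W , f∈X))

  -- An edge of `F` lies within some block, and a vertex shared with `W` identifies that block as
  -- `W`.
  block-closed : ∀ {F Vs} → AllPairs Disjoint Vs → F ⊆ edgesWithin G Vs →
                 ∀ {f W x} → W ∈ˡ Vs → f ∈ F → x ∈ ends G f → x ∈ W → f ∈ E (G [ W ])
  block-closed {Vs = Vs} d F⊆ {x = x} W∈ f∈F x∈f x∈W with X , X∈ , f∈X ← ∈-edgesWithin⁻ Vs (F⊆ f∈F)
    with refl ← disjoint-blocks-≡ d W∈ X∈ x∈W (proj₂ (∈E[]⁻ G f∈X) x∈f) = f∈X

  NoBrokenPath-restrict : ∀ {F W} → NoBrokenPath G F → NoBrokenPath (G [ W ]) (F ∩ E (G [ W ]))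
  NoBrokenPath-restrict {F} {W} nbp j = nbp (joins[]⁻ G j) ∘
    Star.map λ (f , (f∈ , f<e) , j′) → f , (proj₁ (x∈p∩q⁻ F _ f∈) , f<e) , joins[]⁻ G j′

  -- A path in `F` stays in the block where it starts. Hence both ends of `e` lie in that block, and
  -- the path is already forbidden there.
  NoBrokenPath-glue : ∀ {F Vs} → AllPairs Disjoint Vs → ⋃ Vs ≡ V G → F ⊆ edgesWithin G Vs →
                      (∀ {W} → W ∈ˡ Vs → NoBrokenPath (G [ W ]) (F ∩ E (G [ W ]))) → NoBrokenPath G F
  NoBrokenPath-glue {F} {Vs} d cover F⊆ nbp {e} {u} {v} j path
    with W , W∈ , u∈W ← ∈-⋃⁻ Vs (subst (u ∈_) (sym cover) (joins⇒∈V G j)) =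
    let v∈W , path′ = stay u∈W path in nbp W∈ (joins[]⁺ G j u∈W v∈W) path′
    where
    stay : ∀ {x} → x ∈ W → Path G (λ f → f ∈ F × f Fin.< e) x v →
           v ∈ W × Path (G [ W ]) (λ f → f ∈ F ∩ E (G [ W ]) × f Fin.< e) x v
    stay x∈ ε = x∈ , ε
    stay x∈ ((f , (f∈F , f<e) , j) ◅ path)
      with f∈W ← block-closed d F⊆ W∈ f∈F (joins⇒∈ends G j) x∈
      with v∈ , path′ ← stay (proj₂ (∈E[]⁻ G f∈W) (joins⇒∈ends G (joins-sym G j))) path =
      v∈ , (f , (x∈p∩q⁺ (f∈F , f∈W) , f<e) , (f∈W , proj₂ j)) ◅ path′

  -- The tree equations of the blocks are added up; disjoint blocks share neither vertices nor
  -- induced edges, so all sizes add.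
  ∣edges∣+∣blocks∣ : ∀ F {Vs} → AllPairs Disjoint Vs → All (λ W → ∣ F ∩ E (G [ W ]) ∣ + 1 ≡ ∣ W ∣) Vs →
                     ∣ F ∩ edgesWithin G Vs ∣ + length Vs ≡ ∣ ⋃ Vs ∣
  ∣edges∣+∣blocks∣ F [] [] = trans (ℕ.+-identityʳ _)
    (trans (cong ∣_∣ (∩-zeroʳ F)) (trans (∣⊥∣≡0 M) (sym (∣⊥∣≡0 N))))
  ∣edges∣+∣blocks∣ F {W ∷ Vs} (W#Vs ∷ d) (tree ∷ trees) = begin
    ∣ F ∩ (E (G [ W ]) ∪ edgesWithin G Vs) ∣ + suc (length Vs)
      ≡⟨ cong (λ p → ∣ p ∣ + suc (length Vs)) (∩-distribˡ-∪ F _ _) ⟩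
    ∣ (F ∩ E (G [ W ])) ∪ (F ∩ edgesWithin G Vs) ∣ + suc (length Vs)
      ≡⟨ cong (_+ suc (length Vs)) (∣p∪q∣≡∣p∣+∣q∣ (F ∩ E (G [ W ])) (F ∩ edgesWithin G Vs) F-disjoint) ⟩
    (∣ F ∩ E (G [ W ]) ∣ + ∣ F ∩ edgesWithin G Vs ∣) + (1 + length Vs)
      ≡⟨ interchange ∣ F ∩ E (G [ W ]) ∣ ∣ F ∩ edgesWithin G Vs ∣ 1 (length Vs) ⟩
    (∣ F ∩ E (G [ W ]) ∣ + 1) + (∣ F ∩ edgesWithin G Vs ∣ + length Vs)
      ≡⟨ cong₂ _+_ tree (∣edges∣+∣blocks∣ F d trees) ⟩
    ∣ W ∣ + ∣ ⋃ Vs ∣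
      ≡⟨ ∣p∪q∣≡∣p∣+∣q∣ W (⋃ Vs) W-disjoint ⟨
    ∣ W ∪ ⋃ Vs ∣ ∎
    where
    open ≡-Reasoning

    F-disjoint : Disjoint (F ∩ E (G [ W ])) (F ∩ edgesWithin G Vs)
    F-disjoint (f , f∈) with f∈W , f∈Vs ← x∈p∩q⁻ (F ∩ E (G [ W ])) (F ∩ edgesWithin G Vs) f∈ =
      edgesWithin-disjoint W#Vs (f , x∈p∩q⁺ (proj₂ (x∈p∩q⁻ F _ f∈W) , proj₂ (x∈p∩q⁻ F _ f∈Vs)))

    W-disjoint : Disjoint W (⋃ Vs)
    W-disjoint (x , x∈) with x∈W , x∈⋃ ← x∈p∩q⁻ W (⋃ Vs) x∈
      with X , X∈ , x∈X ← ∈-⋃⁻ Vs x∈⋃ = All.lookup W#Vs X∈ (x , x∈p∩q⁺ (x∈W , x∈X))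

  -- A set without broken cycles is a forest, so the size condition makes its
  -- part in each block a spanning tree: the blocks are the components of F.
  Splits : Subset M → List (Subset N) → Set
  Splits F Vs = F ⊆ edgesWithin G Vs × All (λ W → CountedBy-h 1 (G [ W ]) (F ∩ E (G [ W ]))) Vs

  splits? : ∀ F Vs → Dec (Splits F Vs)
  splits? F Vs = (F ⊆? edgesWithin G Vs) ×-dec
                 All.all? (λ W → countedBy-h? 1 (G [ W ]) (F ∩ E (G [ W ]))) Vs

-- The product formula for the edge sets that split along given blocks

module _ (G : OrderedGraph N M) where

  -- The choices in different blocks are independent: cutting off the part of `F` in the first block
  -- is inverse to taking the union with a splitting of the rest.
  #splits≡∏h₁ : ∀ {Vs} → AllPairs Disjoint Vs →
                length (filter (λ F → splits? G F Vs) (allSubsets M)) ≡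
                product (map (λ W → h 1 (G [ W ])) Vs)
  -- Only the empty edge set splits along no blocks, which matches the empty product.
  #splits≡∏h₁ [] = length-filter-unique (λ F → splits? G F []) (allSubsets-unique M) (∈-allSubsets ⊥)
    (id , []) (λ _ (F⊆⊥ , _) → ⊆-antisym F⊆⊥ ⊥⊆)
  #splits≡∏h₁ {W ∷ Vs} (W#Vs ∷ d) = begin
    length (filter (λ F → splits? G F (W ∷ Vs)) (allSubsets M))
      ≡⟨ length-bijection (λ F → F ∩ E[W] , F ∩ E[Vs]) (λ (F₁ , F₂) → F₁ ∪ F₂)
           (Unique.filter⁺ (λ F → splits? G F (W ∷ Vs)) (allSubsets-unique M))
           (Unique.cartesianProduct⁺ (Unique.filter⁺ (countedBy-h? 1 (G [ W ])) (allSubsets-unique M))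
                                     (Unique.filter⁺ (λ F → splits? G F Vs) (allSubsets-unique M)))
           restrict glue glue-restrict restrict-glue ⟩
    length (cartesianProduct trees splittings)
      ≡⟨ length-cartesianProduct trees splittings ⟩
    h 1 (G [ W ]) * length splittings
      ≡⟨ cong (h 1 (G [ W ]) *_) (#splits≡∏h₁ d) ⟩
    h 1 (G [ W ]) * product (map (λ W → h 1 (G [ W ])) Vs) ∎
    where
    open ≡-Reasoning

    E[W] E[Vs] : Subset M
    E[W]  = E (G [ W ])
    E[Vs] = edgesWithin G Vs

    trees splittings : List (Subset M)
    trees      = filter (countedBy-h? 1 (G [ W ])) (allSubsets M)
    splittings = filter (λ F → splits? G F Vs) (allSubsets M)

    disjoint : ∀ {f} → f ∈ E[W] → f ∉ E[Vs]
    disjoint f∈W f∈Vs = edgesWithin-disjoint G W#Vs (_ , x∈p∩q⁺ (f∈W , f∈Vs))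

    E[W]-part : ∀ {F₁ F₂} → F₁ ⊆ E[W] → F₂ ⊆ E[Vs] → (F₁ ∪ F₂) ∩ E[W] ≡ F₁
    E[W]-part {F₁} {F₂} F₁⊆ F₂⊆ = ⊆-antisym to (λ f∈ → x∈p∩q⁺ (x∈p∪q⁺ (inj₁ f∈) , F₁⊆ f∈))
      where
      to : (F₁ ∪ F₂) ∩ E[W] ⊆ F₁
      to f∈ with f∈∪ , f∈W ← x∈p∩q⁻ (F₁ ∪ F₂) E[W] f∈ with x∈p∪q⁻ F₁ F₂ f∈∪
      ... | inj₁ f∈F₁ = f∈F₁
      ... | inj₂ f∈F₂ = contradiction (F₂⊆ f∈F₂) (disjoint f∈W)

    -- The set `p` is left general since it is needed both for each single block and for all of
    -- `E[Vs]`.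
    E[Vs]-part : ∀ {F₁ F₂ p} → F₁ ⊆ E[W] → p ⊆ E[Vs] → (F₁ ∪ F₂) ∩ p ≡ F₂ ∩ p
    E[Vs]-part {F₁} {F₂} {p} F₁⊆ p⊆ = ⊆-antisym to
      (λ f∈ → let f∈F₂ , f∈p = x∈p∩q⁻ F₂ p f∈ in x∈p∩q⁺ (x∈p∪q⁺ (inj₂ f∈F₂) , f∈p))
      where
      to : (F₁ ∪ F₂) ∩ p ⊆ F₂ ∩ p
      to f∈ with f∈∪ , f∈p ← x∈p∩q⁻ (F₁ ∪ F₂) p f∈ with x∈p∪q⁻ F₁ F₂ f∈∪
      ... | inj₁ f∈F₁ = contradiction (p⊆ f∈p) (disjoint (F₁⊆ f∈F₁))
      ... | inj₂ f∈F₂ = x∈p∩q⁺ (f∈F₂ , f∈p)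

    ⊆⇒∩≡ : ∀ {p q : Subset M} → p ⊆ q → p ∩ q ≡ p
    ⊆⇒∩≡ {p} {q} p⊆q = ⊆-antisym (p∩q⊆p p q) (λ x∈ → x∈p∩q⁺ (x∈ , p⊆q x∈))

    splits⁻ : ∀ {F} → F ∈ˡ filter (λ F → splits? G F (W ∷ Vs)) (allSubsets M) → Splits G F (W ∷ Vs)
    splits⁻ = proj₂ ∘ ∈-filter⁻ (λ F → splits? G F (W ∷ Vs)) {xs = allSubsets M}

    factors⁻ : ∀ {F₁₂} → F₁₂ ∈ˡ cartesianProduct trees splittings →
               CountedBy-h 1 (G [ W ]) (proj₁ F₁₂) × Splits G (proj₂ F₁₂) Vs
    factors⁻ F∈ = let F₁∈ , F₂∈ = ∈-cartesianProduct⁻ trees splittings F∈ in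
      proj₂ (∈-filter⁻ (countedBy-h? 1 (G [ W ])) {xs = allSubsets M} F₁∈) ,
      proj₂ (∈-filter⁻ (λ F → splits? G F Vs) {xs = allSubsets M} F₂∈)

    restricts : ∀ {F} → Splits G F (W ∷ Vs) → Splits G (F ∩ E[Vs]) Vs
    restricts {F} (_ , _ ∷ rest) = p∩q⊆q F E[Vs] , All.tabulate λ {X} X∈ →
      subst (CountedBy-h 1 (G [ X ])) (sym (same X∈)) (All.lookup rest X∈)
      where
      same : ∀ {X} → X ∈ˡ Vs → (F ∩ E[Vs]) ∩ E (G [ X ]) ≡ F ∩ E (G [ X ])
      same {X} X∈ = ⊆-antisym
        (λ f∈ → let f∈F , f∈X = x∈p∩q⁻ (F ∩ E[Vs]) (E (G [ X ])) f∈ in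
          x∈p∩q⁺ (p∩q⊆p F E[Vs] f∈F , f∈X))
        (λ f∈ → let f∈F , f∈X = x∈p∩q⁻ F (E (G [ X ])) f∈ in
          x∈p∩q⁺ (x∈p∩q⁺ (f∈F , ∈-edgesWithin⁺ G X∈ f∈X) , f∈X))

    glues : ∀ {F₁ F₂} → CountedBy-h 1 (G [ W ]) F₁ → Splits G F₂ Vs → Splits G (F₁ ∪ F₂) (W ∷ Vs)
    glues {F₁} {F₂} tree@(F₁⊆ , _) (F₂⊆ , rest) =
      ⊆-edges ,
      subst (CountedBy-h 1 (G [ W ])) (sym (E[W]-part F₁⊆ F₂⊆)) tree ∷
      All.tabulate λ {X} X∈ → subst (CountedBy-h 1 (G [ X ]))
        (sym (E[Vs]-part F₁⊆ (∈-edgesWithin⁺ G X∈))) (All.lookup rest X∈)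
      where
      ⊆-edges : F₁ ∪ F₂ ⊆ E[W] ∪ E[Vs]
      ⊆-edges f∈ with x∈p∪q⁻ F₁ F₂ f∈
      ... | inj₁ f∈F₁ = x∈p∪q⁺ (inj₁ (F₁⊆ f∈F₁))
      ... | inj₂ f∈F₂ = x∈p∪q⁺ (inj₂ (F₂⊆ f∈F₂))

    restrict : ∀ {F} → F ∈ˡ filter (λ F → splits? G F (W ∷ Vs)) (allSubsets M) →
               (F ∩ E[W] , F ∩ E[Vs]) ∈ˡ cartesianProduct trees splittings
    restrict F∈ = ∈-cartesianProduct⁺
      (∈-filter⁺ (countedBy-h? 1 (G [ W ])) (∈-allSubsets _) (All.head (proj₂ (splits⁻ F∈))))
      (∈-filter⁺ (λ F → splits? G F Vs) (∈-allSubsets _) (restricts (splits⁻ F∈)))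

    glue : ∀ {F₁₂} → F₁₂ ∈ˡ cartesianProduct trees splittings →
           proj₁ F₁₂ ∪ proj₂ F₁₂ ∈ˡ filter (λ F → splits? G F (W ∷ Vs)) (allSubsets M)
    glue F∈ = let tree , rest = factors⁻ F∈ in
      ∈-filter⁺ (λ F → splits? G F (W ∷ Vs)) (∈-allSubsets _) (glues tree rest)

    glue-restrict : ∀ {F} → F ∈ˡ filter (λ F → splits? G F (W ∷ Vs)) (allSubsets M) →
                    (F ∩ E[W]) ∪ (F ∩ E[Vs]) ≡ F
    glue-restrict {F} F∈ =
      trans (sym (∩-distribˡ-∪ F E[W] E[Vs])) (⊆⇒∩≡ (proj₁ (splits⁻ F∈)))

    restrict-glue : ∀ {F₁₂} → F₁₂ ∈ˡ cartesianProduct trees splittings →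
                    ((proj₁ F₁₂ ∪ proj₂ F₁₂) ∩ E[W] , (proj₁ F₁₂ ∪ proj₂ F₁₂) ∩ E[Vs]) ≡ F₁₂
    restrict-glue F∈ = let (F₁⊆ , _) , F₂⊆ , _ = factors⁻ F∈ in
      cong₂ _,_ (E[W]-part F₁⊆ F₂⊆) (trans (E[Vs]-part F₁⊆ id) (⊆⇒∩≡ F₂⊆))

-- The decomposition into components

module _ {G : OrderedGraph N M} {e : Fin M} (e-max : e IsMaximumOf E G) where

  Avoiding : ℕ → Subset M → Set
  Avoiding k F = CountedBy-h k G F × e ∉ F

  avoiding? : ∀ k → Decidable (Avoiding k)
  avoiding? k F = countedBy-h? k G F ×-dec ¬? (e ∈? F)

  #avoiding : ℕ → ℕ
  #avoiding k = length (filter (avoiding? k) (allSubsets M))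

  -- The edges of a forbidden path are strictly below some edge of `G`, so `e` cannot be among them.
  NoBrokenPath-∪max : ∀ {F} → NoBrokenPath G F → NoBrokenPath G (F ∪ ⁅ e ⁆)
  NoBrokenPath-∪max {F} nbp {f} j = nbp j ∘ Star.map λ (g , (g∈ , g<f) , j′) → g , (g∈F g∈ g<f , g<f) , j′
    where
    g∈F : ∀ {g} → g ∈ F ∪ ⁅ e ⁆ → g Fin.< f → g ∈ F
    g∈F g∈ g<f with x∈p∪q⁻ F ⁅ e ⁆ g∈
    ... | inj₁ g∈F = g∈F
    ... | inj₂ g∈e with refl ← x∈⁅y⁆⇒x≡y e g∈e = contradiction (proj₂ e-max f (proj₁ j)) (ℕ.<⇒≱ g<f)

  remove-max : ∀ {k F} → CountedBy-h k G F × e ∈ F → Avoiding (suc k) (F - e)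
  remove-max {k} {F} ((F⊆E , size , nbc) , e∈F) =
    (F⊆E ∘ x∈p-y⇒x∈p F ,
     trans (ℕ.+-suc _ k) (trans (cong (_+ k) (sym (∣p∣≡1+∣p-x∣ F e∈F))) size) ,
     λ B broken B⊆ → nbc B broken (x∈p-y⇒x∈p F ∘ B⊆)) ,
    x∉p-x F e

  add-max : ∀ {k F} → Avoiding (suc k) F → CountedBy-h k G (F ∪ ⁅ e ⁆) × e ∈ F ∪ ⁅ e ⁆
  add-max {k} {F} ((F⊆E , size , nbc) , e∉F) =
    (⊆E , size′ ,
     noBrokenPath⇒noBrokenCycle G (F ∪ ⁅ e ⁆) (NoBrokenPath-∪max (noBrokenCycle⇒noBrokenPath G F nbc))) ,
    x∈p∪q⁺ (inj₂ (x∈⁅x⁆ e))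
    where
    ⊆E : F ∪ ⁅ e ⁆ ⊆ E G
    ⊆E f∈ with x∈p∪q⁻ F ⁅ e ⁆ f∈
    ... | inj₁ f∈F = F⊆E f∈F
    ... | inj₂ f∈e with refl ← x∈⁅y⁆⇒x≡y e f∈e = proj₁ e-max

    size′ : ∣ F ∪ ⁅ e ⁆ ∣ + k ≡ ∣ V G ∣
    size′ = trans (cong (_+ k) (∣p∪x∣≡1+∣p∣ F e∉F)) (trans (sym (ℕ.+-suc ∣ F ∣ k)) size)

  h-split : ∀ k → h k G ≡ #avoiding k + #avoiding (suc k)
  h-split k = trans (length-filter-split (countedBy-h? k G) (e ∈?_) (allSubsets M))
    (cong (#avoiding k +_)
      (length-bijection (_- e) (_∪ ⁅ e ⁆)
        (Unique.filter⁺ containing? (allSubsets-unique M))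
        (Unique.filter⁺ (avoiding? (suc k)) (allSubsets-unique M))
        (∈-filter⁺ (avoiding? (suc k)) (∈-allSubsets _) ∘ remove-max ∘ containing⁻)
        (∈-filter⁺ containing? (∈-allSubsets _) ∘ add-max ∘ avoiding⁻)
        (p-x∪x ∘ proj₂ ∘ containing⁻)
        (p∪x-x ∘ proj₂ ∘ avoiding⁻)))
    where
    containing? : Decidable (λ F → CountedBy-h k G F × e ∈ F)
    containing? F = countedBy-h? k G F ×-dec (e ∈? F)

    containing⁻ : ∀ {F} → F ∈ˡ filter containing? (allSubsets M) → CountedBy-h k G F × e ∈ F
    containing⁻ = proj₂ ∘ ∈-filter⁻ containing? {xs = allSubsets M}

    avoiding⁻ : ∀ {F} → F ∈ˡ filter (avoiding? (suc k)) (allSubsets M) → Avoiding (suc k) F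
    avoiding⁻ = proj₂ ∘ ∈-filter⁻ (avoiding? (suc k)) {xs = allSubsets M}

  splits⇒avoiding : ∀ {k F Vs} → IsDecomposition G e k Vs → Splits G F Vs → Avoiding k F
  splits⇒avoiding {k} {F} {Vs} (len , _ , d , cover , e∉) (F⊆ , trees) =
    ((λ f∈ → let _ , _ , f∈W = ∈-edgesWithin⁻ G Vs (F⊆ f∈) in proj₁ (∈E[]⁻ G f∈W)) ,
     size ,
     noBrokenPath⇒noBrokenCycle G F (NoBrokenPath-glue G d cover F⊆ λ {W} W∈ →
       noBrokenCycle⇒noBrokenPath (G [ W ]) (F ∩ E (G [ W ])) (proj₂ (proj₂ (All.lookup trees W∈))))) ,
    (λ e∈F → let _ , W∈ , e∈W = ∈-edgesWithin⁻ G Vs (F⊆ e∈F) in All.lookup e∉ W∈ e∈W)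
    where
    size : ∣ F ∣ + k ≡ ∣ V G ∣
    size = begin
      ∣ F ∣ + k                                ≡⟨ cong₂ _+_ (cong ∣_∣ F≡) (sym len) ⟩
      ∣ F ∩ edgesWithin G Vs ∣ + length Vs     ≡⟨ ∣edges∣+∣blocks∣ G F d (All.map (proj₁ ∘ proj₂) trees) ⟩
      ∣ ⋃ Vs ∣                                 ≡⟨ cong ∣_∣ cover ⟩
      ∣ V G ∣                                  ∎
      where
      open ≡-Reasoning
      F≡ : F ≡ F ∩ edgesWithin G Vs
      F≡ = ⊆-antisym (λ f∈ → x∈p∩q⁺ (f∈ , F⊆ f∈)) (p∩q⊆p F _)

  module _ {k : ℕ} {F : Subset M} (F-avoiding : Avoiding k F) where

    private
      F⊆E : F ⊆ E G
      F⊆E = proj₁ (proj₁ F-avoiding)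

      nbp : NoBrokenPath G F
      nbp = noBrokenCycle⇒noBrokenPath G F (proj₂ (proj₂ (proj₁ F-avoiding)))

      T : Rooting G F
      T = noBrokenPath⇒Rooting G F F⊆E nbp

      open Rooting T

      IsComponent : Pred (Subset N) 0ℓ
      IsComponent W = ∃[ v ] (v ∈ V G × W ≡ component T v)

      isComponent? : Decidable IsComponent
      isComponent? W = any? λ v → (v ∈? V G) ×-dec subset-≟ W (component T v)

    -- Filtering `allSubsets N`, rather than listing one component per root, gives each component
    -- once and in the order in which `decompositions` lists blocks.
    components : List (Subset N)
    components = filter isComponent? (allSubsets N)

    private
      components⁺ : ∀ {v} → v ∈ V G → component T v ∈ˡ components
      components⁺ {v} v∈ = ∈-filter⁺ isComponent? (∈-allSubsets _) (v , v∈ , refl)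

      components⁻ : All IsComponent components
      components⁻ = All.tabulate (proj₂ ∘ ∈-filter⁻ isComponent? {xs = allSubsets N})

      self∈component : ∀ {v} → v ∈ V G → v ∈ component T v
      self∈component v∈ = ∈-component⁺ T v∈ refl

      components-disjoint : AllPairs Disjoint components
      components-disjoint = AllPairs-restrict disjoint components⁻
                              (Unique.filter⁺ isComponent? (allSubsets-unique N))
        where
        disjoint : ∀ {W X} → IsComponent W → IsComponent X → W ≢ X → Disjoint W X
        disjoint (v , _ , refl) (w , _ , refl) W≢X (x , x∈) =
          let x∈v , x∈w = x∈p∩q⁻ (component T v) (component T w) x∈ in
          W≢X (component-cong T (trans (sym (proj₂ (∈-component⁻ T x∈v))) (proj₂ (∈-component⁻ T x∈w))))

      components-cover : ⋃ components ≡ V G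
      components-cover = ⊆-antisym to (λ x∈ → ⊆-⋃ (components⁺ x∈) (self∈component x∈))
        where
        to : ⋃ components ⊆ V G
        to x∈ with W , W∈ , x∈W ← ∈-⋃⁻ components x∈
          with v , _ , refl ← All.lookup components⁻ W∈ = proj₁ (∈-component⁻ T x∈W)

      F⊆components : F ⊆ edgesWithin G components
      F⊆components f∈ =
        let u , v , j = ∃-joins G (F⊆E f∈)
            u∈ = joins⇒∈V G j
            v∈ = joins⇒∈V G (joins-sym G j)
        in ∈-edgesWithin⁺ G (components⁺ u∈)
             (proj₁ (joins[]⁺ G j (self∈component u∈) (∈-component⁺ T v∈ (sym (joins⇒root≡ f∈ j)))))

      component-tree : ∀ {W} → IsComponent W → ∣ F ∩ E (G [ W ]) ∣ + 1 ≡ ∣ W ∣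
      component-tree (v , v∈ , refl) = component-edges T v∈

      component-avoids : ∀ {W} → IsComponent W → e ∉ E (G [ W ])
      component-avoids (w , _ , refl) e∈W =
        let u , v , j = ∃-joins G (proj₁ e-max)
            ends⊆ = proj₂ (∈E[]⁻ G e∈W)
            ru = proj₂ (∈-component⁻ T (ends⊆ (joins⇒∈ends G j)))
            rv = proj₂ (∈-component⁻ T (ends⊆ (joins⇒∈ends G (joins-sym G j))))
        in nbp j (Star.map below
             (root≡⇒path (joins⇒∈V G j) (joins⇒∈V G (joins-sym G j)) (trans ru (sym rv))))
        where
        below : ∀ {u v} → Link G (_∈ F) u v → Link G (λ f → f ∈ F × f Fin.< e) u v
        below (f , f∈ , j) =
          f , (f∈ , Fin.≤∧≢⇒< (proj₂ e-max f (F⊆E f∈)) λ { refl → proj₂ F-avoiding f∈ }) , j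

    components-split : Splits G F components
    components-split = F⊆components , All.map counted components⁻
      where
      counted : ∀ {W} → IsComponent W → CountedBy-h 1 (G [ W ]) (F ∩ E (G [ W ]))
      counted {W} W-comp = p∩q⊆q F (E (G [ W ])) , component-tree W-comp ,
        noBrokenPath⇒noBrokenCycle (G [ W ]) (F ∩ E (G [ W ])) (NoBrokenPath-restrict G nbp)

    components-decompose : IsDecomposition G e k components
    components-decompose =
      -- The number of components is read off from the size of `F`: both it and `k` complete `∣ F ∣`
      -- to `∣ V G ∣`.
      ℕ.+-cancelˡ-≡ ∣ F ∣ _ _ (trans size (sym (proj₁ (proj₂ (proj₁ F-avoiding))))) ,
      All.map (λ { (v , v∈ , refl) → v , self∈component v∈ }) components⁻ ,
      components-disjoint ,
      components-cover ,
      All.map component-avoids components⁻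
      where
      size : ∣ F ∣ + length components ≡ ∣ V G ∣
      size = trans (cong (λ p → ∣ p ∣ + length components)
                     (⊆-antisym (λ f∈ → x∈p∩q⁺ (f∈ , F⊆components f∈)) (p∩q⊆p F _)))
               (trans (∣edges∣+∣blocks∣ G F components-disjoint (All.map component-tree components⁻))
                 (cong ∣_∣ components-cover))

    -- No edge of `F` leaves a block, so blocks are unions of components; the size condition in
    -- `Splits` reduces each to a single one, and since the blocks cover `V G`, no component is
    -- missed.
    splitting≡components : ∀ {Vs} → Vs ∈ˡ sublists (allSubsets N) → IsDecomposition G e k Vs →
                           Splits G F Vs → Vs ≡ components
    splitting≡components {Vs} Vs∈ (_ , nonempty , d , cover , _) (F⊆ , trees) =
      sublist≡filter isComponent? (allSubsets-unique N) Vs∈ sound complete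
      where
      ⊆V : ∀ {W} → W ∈ˡ Vs → W ⊆ V G
      ⊆V W∈ x∈ = subst (_ ∈_) cover (⊆-⋃ W∈ x∈)

      closed : ∀ {W} → W ∈ˡ Vs → ∀ {x y} → x ∈ W → Link G (_∈ F) x y → y ∈ W
      closed W∈ x∈ (f , f∈ , j) =
        proj₂ (∈E[]⁻ G (block-closed G d F⊆ W∈ f∈ (joins⇒∈ends G j) x∈)) (joins⇒∈ends G (joins-sym G j))

      block≡component : ∀ {W v} → W ∈ˡ Vs → v ∈ W → W ≡ component T v
      block≡component W∈ = saturated-tree≡component T (⊆V W∈)
        (closed⇒Saturated T (⊆V W∈) (closed W∈)) (proj₁ (proj₂ (All.lookup trees W∈)))

      sound : ∀ {W} → W ∈ˡ Vs → IsComponent W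
      sound W∈ = let v , v∈ = All.lookup nonempty W∈ in v , ⊆V W∈ v∈ , block≡component W∈ v∈

      complete : ∀ {W} → W ∈ˡ allSubsets N → IsComponent W → W ∈ˡ Vs
      complete _ (v , v∈ , refl) =
        let W , W∈ , v∈W = ∈-⋃⁻ Vs (subst (v ∈_) (sym cover) v∈) in
        subst (_∈ˡ Vs) (block≡component W∈ v∈W) W∈

  -- Grouping the avoiding sets by their components

  decompositions-unique : ∀ k → Unique (decompositions G e k)
  decompositions-unique k = Unique.filter⁺ (isDecomposition? G e k) (sublists-unique (allSubsets-unique N))

  #avoiding≡sum : ∀ k → #avoiding k ≡
                  sum (map (λ Vs → product (map (λ W → h 1 (G [ W ])) Vs)) (decompositions G e k))
  #avoiding≡sum k = trans
    (length≡sum-fibre (splits? G) avoiders (decompositions G e k) one)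
    (cong sum (map-cong-local (All.tabulate fibre)))
    where
    avoiders : List (Subset M)
    avoiders = filter (avoiding? k) (allSubsets M)

    decomposition⁻ : ∀ {Vs} → Vs ∈ˡ decompositions G e k →
                     Vs ∈ˡ sublists (allSubsets N) × IsDecomposition G e k Vs
    decomposition⁻ = ∈-filter⁻ (isDecomposition? G e k)

    one : ∀ {F} → F ∈ˡ avoiders → length (filter (splits? G F) (decompositions G e k)) ≡ 1
    one {F} F∈ = length-filter-unique (splits? G F) (decompositions-unique k)
      (∈-filter⁺ (isDecomposition? G e k) (filter∈sublists _ (allSubsets N)) (components-decompose av))
      (components-split av)
      (λ Vs∈ → let Vs∈′ , dec = decomposition⁻ Vs∈ in splitting≡components av Vs∈′ dec)
      where
      av : Avoiding k F
      av = proj₂ (∈-filter⁻ (avoiding? k) {xs = allSubsets M} F∈)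

    fibre : ∀ {Vs} → Vs ∈ˡ decompositions G e k →
            length (filter (λ F → splits? G F Vs) avoiders) ≡ product (map (λ W → h 1 (G [ W ])) Vs)
    fibre {Vs} Vs∈ = trans
      -- Splitting along an admissible decomposition already implies avoiding `e`, so the fibre may
      -- be counted among all edge sets.
      (length-set (Unique.filter⁺ splitting? (Unique.filter⁺ (avoiding? k) (allSubsets-unique M)))
                  (Unique.filter⁺ splitting? (allSubsets-unique M))
                  (λ F∈ → ∈-filter⁺ splitting? (∈-allSubsets _)
                            (proj₂ (∈-filter⁻ splitting? {xs = avoiders} F∈)))
                  (λ F∈ → let F-splits = proj₂ (∈-filter⁻ splitting? {xs = allSubsets M} F∈) in
                    ∈-filter⁺ splitting?
                      (∈-filter⁺ (avoiding? k) (∈-allSubsets _) (splits⇒avoiding dec F-splits)) F-splits))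
      (#splits≡∏h₁ G (proj₁ (proj₂ (proj₂ dec))))
      where
      dec : IsDecomposition G e k Vs
      dec = proj₂ (decomposition⁻ Vs∈)

      splitting? : Decidable (λ F → Splits G F Vs)
      splitting? F = splits? G F Vs

  -- A single block would be all of `V G` and so would induce `e`. This reconciles the sum formula
  -- at one block with the value `0` fixed for `c zero`.
  no-decomposition₁ : ∀ {Vs} → ¬ IsDecomposition G e 1 Vs
  no-decomposition₁ {W ∷ []} (_ , _ , _ , cover , e∉ ∷ []) =
    e∉ (∈E[]⁺ G (proj₁ e-max) λ x∈ →
      subst (_ ∈_) (trans (sym cover) (∪-identityʳ W)) (ends⊆V G (proj₁ e-max) x∈))

  decompositions₁≡[] : decompositions G e 1 ≡ []
  decompositions₁≡[] = filter-none (isDecomposition? G e 1) {xs = sublists (allSubsets N)}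
    (All.tabulate λ _ → no-decomposition₁)

  #avoiding≡c : ∀ k → #avoiding (suc k) ≡ c k G e
  #avoiding≡c zero    = trans (#avoiding≡sum 1)
    (cong (λ Vss → sum (map (λ Vs → product (map (λ W → h 1 (G [ W ])) Vs)) Vss)) decompositions₁≡[])
  #avoiding≡c (suc k) = #avoiding≡sum (suc (suc k))

lemma2p6 : ∀ {N M : ℕ} (G : OrderedGraph N M) → Nonempty (V G) → Nonempty (E G) →
    (eₘₐₓ : Fin M) → eₘₐₓ IsMaximumOf (E G) →
    ∀ (i : ℕ) → 1 ≤ i → h i G ≡ c (i ∸ 1) G eₘₐₓ + c i G eₘₐₓ
lemma2p6 G _ _ e e-max (suc k) _ =
  trans (h-split {G = G} e-max (suc k))
        (cong₂ _+_ (#avoiding≡c {G = G} e-max k) (#avoiding≡c {G = G} e-max (suc k)))
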